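{- Let $G$ be a full DAG with an ample framing $F$. Then the convex hull of the characteristic vectors of the exceptional routes of $F$ is a special simplex for the flow polytope $\mathcal{F}_1(G)$.
   Context: A DAG is a finite directed acyclic graph, possibly with multiple edges; sources have no incoming edges, sinks no outgoing edges, other vertices are inner; $\mathrm{in}(v),\mathrm{out}(v)$ are incoming/outgoing edges. $G$ is full if every inner vertex $v$ has $|\mathrm{in}(v)|=|\mathrm{out}(v)|=2$. A route is a maximal directed path (source to sink); its characteristic vector $v_R\in\mathbb{R}^{E(G)}$ is the indicator vector of its edges. The flow polytope $\mathcal{F}_1(G)\subset\mathbb{R}^{E(G)}$ is the set of nonnegative $f$ satisfying flow conservation at every inner vertex with total outflow from sources equal to $1$; its vertices are the $v_R$. A framing assigns to each inner vertex $v$ linear orders $\prec$ on $\mathrm{in}(v)$ and $\mathrm{out}(v)$. For inner $v$, paths in $\mathrm{Out}(v)$ (from $v$ to a sink) are compared by $P\prec Q$ iff at the last vertex $w$ of their common initial segment the edge of $P$ leaving $w$ precedes that of $Q$ in $\mathrm{out}(w)$; analogously for $\mathrm{In}(v)$ (paths from a source to $v$) at the first vertex of their common final segment using $\mathrm{in}(w)$. For a route $R$ through $v$, $Rv$, $vR$ are its parts before/after $v$. Routes $P,Q$ through a common inner vertex $v$ conflict at $v$ if, after possibly swapping them, $Pv\prec Qv$ and $vQ\prec vP$; coherent if no conflict at any common inner vertex. A route is exceptional if coherent with all routes. With $\mathcal{F}_+(G)$ the cone of nonnegative flows, a framing is ample if $\{v_R:R\text{ exceptional}\}$ lies in no facet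 of $\mathcal{F}_+(G)$ (equivalently, every non-idle edge lies on an exceptional route). For a lattice polytope $P$ (here Gorenstein), a simplex $S$ whose vertices are lattice points of $P$ is special if the intersection of every facet of $P$ with $S$ is a facet of $S$.
   Formalization: The flow polytope, the cone of nonnegative flows, the convex hull and the hyperplanes defining facets are taken in rational space ℚ^{E(G)} with rational coefficients instead of in ℝ^{E(G)}. -}

module Defs where

open import Level using (0ℓ)
open import Data.Nat as ℕ using (ℕ; zero; suc)
open import Data.Fin using (Fin; zero; suc)
open import Data.Fin.Properties using () renaming (_≟_ to _≟ᶠ_)
open import Data.List using (List; allFin; []; _∷_; _++_; _∷ʳ_; length; filter; reverse; foldr; map)
open import Data.List.Relation.Unary.Any using (any?)
open import Data.Integer using (ℤ)
open import Data.Rational using (ℚ; 0ℚ; 1ℚ; _+_; _*_; _≤_; _/_)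
open import Data.Product using (Σ; ∃; _×_; _,_)
open import Data.Empty using (⊥)
open import Data.Sum using (_⊎_)
open import Relation.Nullary using (¬_; does)
open import Relation.Binary.PropositionalEquality using (_≡_; _≢_)
open import Data.Bool using (if_then_else_)
open import Function.Bundles using (_⇔_)
import Data.Fin as F

Vecℚ : ℕ → Set
Vecℚ d = Fin d → ℚ

∑ : (k : ℕ) → (Fin k → ℚ) → ℚ
∑ zero    f = 0ℚ
∑ (suc k) f = f zero + ∑ k (λ j → f (suc j))

dot : {d : ℕ} → Vecℚ d → Vecℚ d → ℚ
dot {d} a x = ∑ d (λ i → a i * x i)

Subset : ℕ → Set₁
Subset d = Vecℚ d → Set

AffIndep : {d k : ℕ} → (Fin k → Vecℚ d) → Set
AffIndep {d} {k} p =
  (c : Fin k → ℚ) →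
  (∀ i → ∑ k (λ j → c j * p j i) ≡ 0ℚ) →
  ∑ k c ≡ 0ℚ →
  ∀ j → c j ≡ 0ℚ

HasAffIndep : {d : ℕ} → Subset d → ℕ → Set
HasAffIndep {d} S k = Σ (Fin k → Vecℚ d) λ p → (∀ j → S (p j)) × AffIndep p

-- AffRank S r : the maximal number of affinely independent points of S is r,
-- i.e. dim S = r - 1 (r = 0 for the empty set)
AffRank : {d : ℕ} → Subset d → ℕ → Set
AffRank S r = HasAffIndep S r × ¬ HasAffIndep S (suc r)

IsFace : {d : ℕ} → Subset d → Subset d → Set
IsFace {d} P F =
  Σ (Vecℚ d) λ a → Σ ℚ λ b →
    (∀ x → P x → dot a x ≤ b) ×
    (∀ x → F x ⇔ (P x × dot a x ≡ b))

IsFacet : {d : ℕ} → Subset d → Subset d → Set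
IsFacet P F = IsFace P F × Σ ℕ λ r → AffRank P (suc r) × AffRank F r

ConvHull : {d : ℕ} → Subset d → Subset d
ConvHull {d} A x =
  Σ ℕ λ k → Σ (Fin k → Vecℚ d) λ p → Σ (Fin k → ℚ) λ c →
    (∀ j → A (p j)) × (∀ j → 0ℚ ≤ c j) × (∑ k c ≡ 1ℚ) ×
    (∀ i → x i ≡ ∑ k (λ j → c j * p j i))

ConvHullOf : {d k : ℕ} → (Fin k → Vecℚ d) → Subset d
ConvHullOf {d} {k} p x =
  Σ (Fin k → ℚ) λ c →
    (∀ j → 0ℚ ≤ c j) × (∑ k c ≡ 1ℚ) ×
    (∀ i → x i ≡ ∑ k (λ j → c j * p j i))

IsLatticePoint : {d : ℕ} → Vecℚ d → Set
IsLatticePoint x = ∀ i → ∃ λ (z : ℤ) → x i ≡ z / 1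

IsSpecialSimplex : {d : ℕ} → Subset d → Subset d → Set₁
IsSpecialSimplex {d} P S =
  (Σ ℕ λ k → Σ (Fin k → Vecℚ d) λ p →
      AffIndep p × (∀ j → IsLatticePoint (p j) × P (p j)) ×
      (∀ x → S x ⇔ ConvHullOf p x)) ×
  (∀ (F : Subset d) → IsFacet P F → IsFacet S (λ x → F x × S x))

record Digraph : Set where
  field
    nV  : ℕ
    nE  : ℕ
    src : Fin nE → Fin nV
    tgt : Fin nE → Fin nV

module _ (G : Digraph) where
  open Digraph G

  V E : Set
  V = Fin nV
  E = Fin nE

  data IsPath : List E → Set where
    []  : IsPath []
    [_] : (e : E) → IsPath (e ∷ [])
    _∷_ : {e e' : E} {es : List E} → tgt e ≡ src e' →
          IsPath (e' ∷ es) → IsPath (e ∷ e' ∷ es)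

  lastEdge : E → List E → E
  lastEdge e []        = e
  lastEdge e (e' ∷ es) = lastEdge e' es

  IsAcyclic : Set
  IsAcyclic = ∀ (e : E) (es : List E) → IsPath (e ∷ es) → src e ≢ tgt (lastEdge e es)

  inDeg outDeg : V → ℕ
  inDeg  v = length (filter (λ e → tgt e ≟ᶠ v) (allFin nE))
  outDeg v = length (filter (λ e → src e ≟ᶠ v) (allFin nE))

  IsSource IsSink IsInner : V → Set
  IsSource v = inDeg v ≡ 0
  IsSink   v = outDeg v ≡ 0
  IsInner  v = ¬ IsSource v × ¬ IsSink v

  IsFull : Set
  IsFull = ∀ v → IsInner v → inDeg v ≡ 2 × outDeg v ≡ 2

  -- a route: a (nonempty) directed path from a source to a sink
  -- (in a DAG these are exactly the maximal directed paths)
  IsRoute : List E → Set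
  IsRoute []       = ⊥
  IsRoute (e ∷ es) = IsPath (e ∷ es) × IsSource (src e) × IsSink (tgt (lastEdge e es))

  χ : List E → Vecℚ nE
  χ R e = if does (any? (λ e' → e ≟ᶠ e') R) then 1ℚ else 0ℚ

  Conservation : Vecℚ nE → Set
  Conservation f = ∀ v → IsInner v →
    ∑ nE (λ e → if does (tgt e ≟ᶠ v) then f e else 0ℚ) ≡
    ∑ nE (λ e → if does (src e ≟ᶠ v) then f e else 0ℚ)

  FlowCone : Subset nE
  FlowCone f = (∀ e → 0ℚ ≤ f e) × Conservation f

  FlowPolytope : Subset nE
  FlowPolytope f = FlowCone f ×
    ∑ nE (λ e → if does (inDeg (src e) ℕ.≟ 0) then f e else 0ℚ) ≡ 1ℚ

  -- a framing: linear orders on in(v) and out(v) for inner v, encoded by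
  -- ranks that are injective on in(v) (resp. out(v)) for each inner v;
  -- edge e precedes e' in in(v) iff inRank e < inRank e'.
  record Framing : Set where
    field
      inRank  : E → ℕ
      outRank : E → ℕ
      inRank-inj  : ∀ e e' → tgt e ≡ tgt e' → IsInner (tgt e) →
                    inRank e ≡ inRank e' → e ≡ e'
      outRank-inj : ∀ e e' → src e ≡ src e' → IsInner (src e) →
                    outRank e ≡ outRank e' → e ≡ e'

  module _ (Fr : Framing) where
    open Framing Fr

    data OutLt : List E → List E → Set where
      here  : {e e' : E} {P Q : List E} → outRank e ℕ.< outRank e' →
              OutLt (e ∷ P) (e' ∷ Q)
      there : {e : E} {P Q : List E} → OutLt P Q → OutLt (e ∷ P) (e ∷ Q)

    data InLtRev : List E → List E → Set where
      here  : {e e' : E} {P Q : List E} → inRank e ℕ.< inRank e' →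
              InLtRev (e ∷ P) (e' ∷ Q)
      there : {e : E} {P Q : List E} → InLtRev P Q → InLtRev (e ∷ P) (e ∷ Q)

    -- P ≺ Q for paths in In(v): compare at the first vertex of the common
    -- final segment using the order on incoming edges
    InLt : List E → List E → Set
    InLt P Q = InLtRev (reverse P) (reverse Q)

    SplitAt : List E → V → List E → List E → Set
    SplitAt R v A B = R ≡ A ++ B ×
      Σ (List E) λ A' → Σ E λ e → A ≡ A' ∷ʳ e × tgt e ≡ v

    ConflictAt : List E → List E → V → Set
    ConflictAt P Q v =
      Σ (List E) λ Pv → Σ (List E) λ vP → Σ (List E) λ Qv → Σ (List E) λ vQ →
        SplitAt P v Pv vP × SplitAt Q v Qv vQ ×
        ((InLt Pv Qv × OutLt vQ vP) ⊎ (InLt Qv Pv × OutLt vP vQ))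

    Coherent : List E → List E → Set
    Coherent P Q = ∀ v → IsInner v → ¬ ConflictAt P Q v

    IsExceptional : List E → Set
    IsExceptional R = IsRoute R × (∀ Q → IsRoute Q → Coherent R Q)

    ExceptionalVectors : Subset nE
    ExceptionalVectors x = Σ (List E) λ R → IsExceptional R × (∀ e → x e ≡ χ R e)

    IsAmple : Set₁
    IsAmple = ∀ (Fc : Subset nE) → IsFacet FlowCone Fc →
      ¬ (∀ x → ExceptionalVectors x → Fc x)

module Submission where

open import Defs
open import Algebra.Bundles using (CommutativeMonoid; CommutativeRing)
import Algebra.Properties.CommutativeMonoid.Sum
import Algebra.Properties.CommutativeSemigroup
import Algebra.Properties.Group
import Algebra.Properties.Semiring.Sum
open import Data.Bool using (Bool; true; false; if_then_else_)
open import Data.Empty using (⊥)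
open import Data.Fin using (Fin; zero; suc; punchIn)
open import Data.Fin.Induction using (spo-wellFounded; spo-noetherian)
open import Data.Fin.Properties using (any?; punchInᵢ≢i) renaming (_≟_ to _≟ᶠ_)
import Data.Integer as ℤ
open import Data.List as List using (List; []; _∷_; _++_; _∷ʳ_; length; filter; allFin)
open import Data.List.Membership.Propositional using (_∈_; _∉_)
open import Data.List.Membership.Propositional.Properties using (∈-filter⁺; ∈-filter⁻; ∈-allFin; ∈-lookup; ∈-++⁺ʳ)
open import Data.List.Properties using (∷ʳ-++; reverse-++)
open import Data.List.Relation.Unary.All as All using (All; []; _∷_)
import Data.List.Relation.Unary.All.Properties as All
open import Data.List.Relation.Unary.AllPairs using ([]; _∷_)
open import Data.List.Relation.Unary.Any as Any using (here; there)
open import Data.List.Relation.Unary.Any.Properties using (lookup-index)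
open import Data.List.Relation.Unary.Linked using (Linked; [-]; _∷_)
open import Data.List.Relation.Unary.Unique.Propositional using (Unique)
import Data.List.Relation.Unary.Unique.Propositional.Properties as Unique
open import Data.Nat as ℕ using (ℕ; zero; suc)
import Data.Nat.Properties as ℕ
open import Data.Product using (Σ; ∃; _×_; _,_; proj₁; proj₂; map₂)
open import Data.Rational hiding (truncate)
open import Data.Rational.Properties as ℚ using (_≟_)
open import Data.Rational.Solver using (module +-*-Solver)
open import Data.Sum using (_⊎_; inj₁; inj₂; [_,_]′)
open import Data.Unit using (⊤; tt)
open import Data.Vec.Functional using (insertAt; removeAt) renaming (_∷_ to infixr 5 _◂_; [] to ◂[])
open import Data.Vec.Functional.Properties using (insertAt-lookup; insertAt-punchIn)
open import Function using (_∘_; flip)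
open import Function.Bundles using (_⇔_; mk⇔; Equivalence)
open import Induction.WellFounded using (Acc; acc)
open import Relation.Binary using (IsStrictPartialOrder; tri<; tri≈; tri>)
open import Relation.Binary.PropositionalEquality
open import Relation.Nullary using (¬_; yes; no; Dec; does; ¬?; contradiction; decidable-stable; _×-dec_; _⊎-dec_)
open import Relation.Nullary.Decidable using (dec-true; dec-false)
open Algebra.Properties.CommutativeSemigroup (CommutativeMonoid.commutativeSemigroup ℚ.*-1-commutativeMonoid) using (x∙yz≈y∙xz)
open Algebra.Properties.Group ℚ.+-0-group using (x∙y⁻¹≈ε⇒x≈y)
module Sum = Algebra.Properties.CommutativeMonoid.Sum ℚ.+-0-commutativeMonoid
module SemiringSum = Algebra.Properties.Semiring.Sum (CommutativeRing.semiring ℚ.+-*-commutativeRing)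
open Sum using (sum)
open +-*-Solver using (solve; _:=_; _:+_; _:*_; :-_; con)
open ≡-Reasoning

-- A route that crosses from the lower incoming to the upper outgoing edge of an inner vertex (or from upper
-- to lower) conflicts with a route through the other two edges, so exceptional routes are straight. Straight
-- routes through a common edge coincide, and by ampleness every edge lies on an exceptional route: the
-- exceptional routes partition the edge set. Their vectors are therefore independent. A facet F of the flow
-- polytope lies in some hyperplane f(e) = 0 (a flow with full support is interior), so it misses the
-- exceptional vertex through e; missing another one as well would give two points extending an affine basis
-- of F, against dim F = dim P - 1.
-- Ampleness is stated through the facets of the flow cone. Every edge e of a full DAG gives such a facet
-- f(e) = 0, since each vertex offers an alternative to e and hence all other edges carry flow avoiding e.
-- Dimensions are only known to exist up to double negation, which suffices because exceptionality is a
-- negative statement.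

-- Linear algebra over ℚ

∑≡sum : ∀ {n} (f : Fin n → ℚ) → ∑ n f ≡ sum f
∑≡sum {zero}  f = refl
∑≡sum {suc n} f = cong (f zero +_) (∑≡sum (f ∘ suc))

∑-cong : ∀ n {f g : Fin n → ℚ} → (∀ i → f i ≡ g i) → ∑ n f ≡ ∑ n g
∑-cong zero    eq = refl
∑-cong (suc n) eq = cong₂ _+_ (eq zero) (∑-cong n (eq ∘ suc))

∑-zero : ∀ n {f : Fin n → ℚ} → (∀ i → f i ≡ 0ℚ) → ∑ n f ≡ 0ℚ
∑-zero zero    eq = refl
∑-zero (suc n) eq = trans (cong₂ _+_ (eq zero) (∑-zero n (eq ∘ suc))) (ℚ.+-identityˡ 0ℚ)

∑-+ : ∀ n (f g : Fin n → ℚ) → ∑ n (λ i → f i + g i) ≡ ∑ n f + ∑ n g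
∑-+ n f g = begin
  ∑ n (λ i → f i + g i) ≡⟨ ∑≡sum (λ i → f i + g i) ⟩
  sum (λ i → f i + g i) ≡⟨ Sum.∑-distrib-+ f g ⟩
  sum f + sum g         ≡⟨ cong₂ _+_ (∑≡sum f) (∑≡sum g) ⟨
  ∑ n f + ∑ n g         ∎

∑-*ˡ : ∀ n c (f : Fin n → ℚ) → ∑ n (λ i → c * f i) ≡ c * ∑ n f
∑-*ˡ n c f = begin
  ∑ n (λ i → c * f i) ≡⟨ ∑≡sum (λ i → c * f i) ⟩
  sum (λ i → c * f i) ≡⟨ SemiringSum.*-distribˡ-sum c f ⟨
  c * sum f           ≡⟨ cong (c *_) (∑≡sum f) ⟨
  c * ∑ n f           ∎

∑-*ʳ : ∀ n c (f : Fin n → ℚ) → ∑ n (λ i → f i * c) ≡ ∑ n f * c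
∑-*ʳ n c f = begin
  ∑ n (λ i → f i * c) ≡⟨ ∑-cong n (λ i → ℚ.*-comm (f i) c) ⟩
  ∑ n (λ i → c * f i) ≡⟨ ∑-*ˡ n c f ⟩
  c * ∑ n f           ≡⟨ ℚ.*-comm c (∑ n f) ⟩
  ∑ n f * c           ∎

∑-comm : ∀ m n (f : Fin m → Fin n → ℚ) →
         ∑ m (λ i → ∑ n (f i)) ≡ ∑ n (λ j → ∑ m (λ i → f i j))
∑-comm zero    n f = sym (∑-zero n (λ _ → refl))
∑-comm (suc m) n f =
  trans (cong (∑ n (f zero) +_) (∑-comm m n (f ∘ suc))) (sym (∑-+ n (f zero) (λ j → ∑ m (λ i → f (suc i) j))))

∑-remove : ∀ {n} (i : Fin (suc n)) (f : Fin (suc n) → ℚ) → ∑ (suc n) f ≡ f i + ∑ n (f ∘ punchIn i)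
∑-remove {n} i f = begin
  ∑ (suc n) f               ≡⟨ ∑≡sum f ⟩
  sum f                     ≡⟨ Sum.sum-remove {i = i} f ⟩
  f i + sum (removeAt f i)  ≡⟨ cong (f i +_) (∑≡sum (f ∘ punchIn i)) ⟨
  f i + ∑ n (f ∘ punchIn i) ∎

∑-nonneg : ∀ n {f : Fin n → ℚ} → (∀ i → 0ℚ ≤ f i) → 0ℚ ≤ ∑ n f
∑-nonneg zero    nn = ℚ.≤-refl
∑-nonneg (suc n) nn = ℚ.+-mono-≤ (nn zero) (∑-nonneg n (nn ∘ suc))

≤∑ : ∀ {n} (f : Fin n → ℚ) → (∀ i → 0ℚ ≤ f i) → ∀ i → f i ≤ ∑ n f
≤∑ {suc n} f nn i = subst₂ _≤_ (ℚ.+-identityʳ (f i)) (sym (∑-remove i f))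
  (ℚ.+-monoʳ-≤ (f i) (∑-nonneg n (nn ∘ punchIn i)))

*-nonneg : ∀ {p q} → 0ℚ ≤ p → 0ℚ ≤ q → 0ℚ ≤ p * q
*-nonneg {p} {q} 0≤p 0≤q =
  ℚ.nonNegative⁻¹ (p * q) {{ℚ.nonNeg*nonNeg⇒nonNeg p {{nonNegative 0≤p}} q {{nonNegative 0≤q}}}}

*-cancel-zero : ∀ {p q} → p ≢ 0ℚ → p * q ≡ 0ℚ → q ≡ 0ℚ
*-cancel-zero {p} {q} p≢0 pq≡0 = begin
  q              ≡⟨ ℚ.*-identityˡ q ⟨
  1ℚ * q         ≡⟨ cong (_* q) (ℚ.*-inverseˡ p) ⟨
  1/ p * p * q   ≡⟨ ℚ.*-assoc (1/ p) p q ⟩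
  1/ p * (p * q) ≡⟨ cong (1/ p *_) pq≡0 ⟩
  1/ p * 0ℚ      ≡⟨ ℚ.*-zeroʳ (1/ p) ⟩
  0ℚ             ∎
  where instance _ = ≢-nonZero p≢0

-- Recursion on the indices, instead of a decision of equality, lets the sums below reduce one index
-- at a time.
δ : ∀ {n} → Fin n → Fin n → ℚ
δ zero    zero    = 1ℚ
δ zero    (suc _) = 0ℚ
δ (suc _) zero    = 0ℚ
δ (suc i) (suc j) = δ i j

∑-δ : ∀ {n} (i : Fin n) (f : Fin n → ℚ) → ∑ n (λ j → δ i j * f j) ≡ f i
∑-δ {suc n} zero f = begin
  1ℚ * f zero + ∑ n (λ j → 0ℚ * f (suc j))
    ≡⟨ cong₂ _+_ (ℚ.*-identityˡ (f zero)) (∑-zero n (λ j → ℚ.*-zeroˡ (f (suc j)))) ⟩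
  f zero + 0ℚ ≡⟨ ℚ.+-identityʳ (f zero) ⟩
  f zero      ∎
∑-δ {suc n} (suc i) f = begin
  0ℚ * f zero + ∑ n (λ j → δ i j * f (suc j)) ≡⟨ cong₂ _+_ (ℚ.*-zeroˡ (f zero)) (∑-δ i (f ∘ suc)) ⟩
  0ℚ + f (suc i)                              ≡⟨ ℚ.+-identityˡ (f (suc i)) ⟩
  f (suc i)                                   ∎

∑-δ-total : ∀ {n} (i : Fin n) → ∑ n (δ i) ≡ 1ℚ
∑-δ-total {n} i = trans (∑-cong n (λ j → sym (ℚ.*-identityʳ (δ i j)))) (∑-δ i (λ _ → 1ℚ))

δ-nonneg : ∀ {n} (i j : Fin n) → 0ℚ ≤ δ i j
δ-nonneg zero    zero    = ℚ.nonNegative⁻¹ 1ℚ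
δ-nonneg zero    (suc j) = ℚ.≤-refl
δ-nonneg (suc i) zero    = ℚ.≤-refl
δ-nonneg (suc i) (suc j) = δ-nonneg i j

δ-refl : ∀ {n} (i : Fin n) → δ i i ≡ 1ℚ
δ-refl zero    = refl
δ-refl (suc i) = δ-refl i

δ-≢ : ∀ {n} {i j : Fin n} → i ≢ j → δ i j ≡ 0ℚ
δ-≢ {i = zero}  {zero}  i≢j = contradiction refl i≢j
δ-≢ {i = zero}  {suc j} i≢j = refl
δ-≢ {i = suc i} {zero}  i≢j = refl
δ-≢ {i = suc i} {suc j} i≢j = δ-≢ (i≢j ∘ cong suc)

comb : ∀ {d k} → (Fin k → ℚ) → (Fin k → Vecℚ d) → Vecℚ d
comb {k = k} c p i = ∑ k (λ j → c j * p j i)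

comb-comb : ∀ {d k m} (c : Fin k → ℚ) (C : Fin k → Fin m → ℚ) (q : Fin m → Vecℚ d) i →
            comb c (λ j → comb (C j) q) i ≡ comb (comb c C) q i
comb-comb {k = k} {m} c C q i = begin
  ∑ k (λ j → c j * ∑ m (λ l → C j l * q l i))
    ≡⟨ ∑-cong k (λ j → sym (∑-*ˡ m (c j) (λ l → C j l * q l i))) ⟩
  ∑ k (λ j → ∑ m (λ l → c j * (C j l * q l i)))
    ≡⟨ ∑-comm k m (λ j l → c j * (C j l * q l i)) ⟩
  ∑ m (λ l → ∑ k (λ j → c j * (C j l * q l i)))
    ≡⟨ ∑-cong m (λ l → trans (∑-cong k (λ j → sym (ℚ.*-assoc (c j) (C j l) (q l i))))
                             (∑-*ʳ k (q l i) (λ j → c j * C j l))) ⟩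
  ∑ m (λ l → ∑ k (λ j → c j * C j l) * q l i) ∎

dot-cong : ∀ {d} (a : Vecℚ d) {x y : Vecℚ d} → (∀ i → x i ≡ y i) → dot a x ≡ dot a y
dot-cong {d} a eq = ∑-cong d (λ i → cong (a i *_) (eq i))

dot-comb : ∀ {d k} (a : Vecℚ d) (c : Fin k → ℚ) (p : Fin k → Vecℚ d) →
           dot a (comb c p) ≡ ∑ k (λ j → c j * dot a (p j))
dot-comb {d} {k} a c p = begin
  ∑ d (λ i → a i * ∑ k (λ j → c j * p j i))
    ≡⟨ ∑-cong d (λ i → ∑-*ˡ k (a i) (λ j → c j * p j i)) ⟨
  ∑ d (λ i → ∑ k (λ j → a i * (c j * p j i)))
    ≡⟨ ∑-comm d k (λ i j → a i * (c j * p j i)) ⟩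
  ∑ k (λ j → ∑ d (λ i → a i * (c j * p j i)))
    ≡⟨ ∑-cong k (λ j → trans (∑-cong d (λ i → x∙yz≈y∙xz (a i) (c j) (p j i)))
                             (∑-*ˡ d (c j) (λ i → a i * p j i))) ⟩
  ∑ k (λ j → c j * ∑ d (λ i → a i * p j i)) ∎

∑-insertAt : ∀ {n} (i : Fin (suc n)) (c : Fin n → ℚ) v (g : Fin (suc n) → ℚ) →
             ∑ (suc n) (λ j → insertAt c i v j * g j) ≡ v * g i + ∑ n (λ j → c j * g (punchIn i j))
∑-insertAt {n} i c v g = trans (∑-remove i (λ j → insertAt c i v j * g j)) (cong₂ _+_
  (cong (_* g i) (insertAt-lookup c i v))
  (∑-cong n (λ j → cong (_* g (punchIn i j)) (insertAt-punchIn c i v j))))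

-- Both pivoting steps below (elimination in a linear system and in a family of vectors) rest on
-- this identity; it avoids division by scaling the other coefficients by the pivot α.
pivot-identity : ∀ {n} (α β : ℚ) (c x y : Fin n → ℚ) →
  - ∑ n (λ j → c j * y j) * β + ∑ n (λ j → (α * c j) * x j) ≡
  ∑ n (λ j → c j * (α * x j - y j * β))
pivot-identity {n} α β c x y = begin
  - ∑ n (λ j → c j * y j) * β + ∑ n (λ j → (α * c j) * x j)
    ≡⟨ cong (_+ ∑ n (λ j → (α * c j) * x j)) (trans
         (solve 2 (λ s β → (:- s) :* β := (:- β) :* s) refl (∑ n (λ j → c j * y j)) β)
         (sym (∑-*ˡ n (- β) (λ j → c j * y j)))) ⟩
  ∑ n (λ j → - β * (c j * y j)) + ∑ n (λ j → (α * c j) * x j)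
    ≡⟨ ∑-+ n (λ j → - β * (c j * y j)) (λ j → (α * c j) * x j) ⟨
  ∑ n (λ j → - β * (c j * y j) + (α * c j) * x j)
    ≡⟨ ∑-cong n (λ j → solve 5 (λ α β c x y →
         (:- β) :* (c :* y) :+ (α :* c) :* x := c :* (α :* x :+ (:- (y :* β)))) refl α β (c j) (x j) (y j)) ⟩
  ∑ n (λ j → c j * (α * x j - y j * β)) ∎

pivot-zero : ∀ α c y → c * (α * y - y * α) ≡ 0ℚ
pivot-zero = solve 3 (λ α c y → c :* (α :* y :+ (:- (y :* α))) := con 0ℚ) refl

-- Gaussian elimination, by induction on the number of equations. If the first equation is
-- identically zero, it is dropped together with one unknown; otherwise an unknown with nonzero
-- coefficient in it is eliminated from the others.
nontrivial-solution : ∀ k (A : Fin k → Fin (suc k) → ℚ) →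
  Σ (Fin (suc k) → ℚ) λ c → (∃ λ j → c j ≢ 0ℚ) × (∀ i → ∑ (suc k) (λ j → c j * A i j) ≡ 0ℚ)
nontrivial-solution zero    A = (λ _ → 1ℚ) , (zero , λ ()) , λ ()
nontrivial-solution (suc k) A with any? (λ j → ¬? (A zero j ≟ 0ℚ))
... | no all-zero = 0ℚ ◂ c , (suc j , cj≢0) , eqs
  where
  sol = nontrivial-solution k (λ i j → A (suc i) (suc j))
  c = proj₁ sol
  j = proj₁ (proj₁ (proj₂ sol))
  cj≢0 = proj₂ (proj₁ (proj₂ sol))
  eqs : ∀ i → ∑ (suc (suc k)) (λ j → (0ℚ ◂ c) j * A i j) ≡ 0ℚ
  eqs zero    = ∑-zero (suc (suc k)) (λ j → trans
    (cong ((0ℚ ◂ c) j *_) (decidable-stable (A zero j ≟ 0ℚ) (λ ne → all-zero (j , ne))))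
    (ℚ.*-zeroʳ ((0ℚ ◂ c) j)))
  eqs (suc i) = trans (cong₂ _+_ (ℚ.*-zeroˡ (A (suc i) zero)) (proj₂ (proj₂ sol) i)) (ℚ.+-identityˡ 0ℚ)
... | yes (j₀ , α≢0) = d , (punchIn j₀ j , dj≢0) , eqs
  where
  α = A zero j₀
  row = A zero ∘ punchIn j₀
  sol = nontrivial-solution k (λ i j → α * A (suc i) (punchIn j₀ j) - row j * A (suc i) j₀)
  c = proj₁ sol
  j = proj₁ (proj₁ (proj₂ sol))
  -- With the other unknowns scaled by `α`, this value at `j₀` solves the first equation.
  d = insertAt (λ j → α * c j) j₀ (- ∑ (suc k) (λ j → c j * row j))
  dj≢0 : d (punchIn j₀ j) ≢ 0ℚ
  dj≢0 dj≡0 = proj₂ (proj₁ (proj₂ sol))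
    (*-cancel-zero α≢0 (trans (sym (insertAt-punchIn (λ j → α * c j) j₀ _ j)) dj≡0))
  expand : ∀ i → ∑ (suc (suc k)) (λ j → d j * A i j) ≡
                 ∑ (suc k) (λ j → c j * (α * A i (punchIn j₀ j) - row j * A i j₀))
  expand i = trans (∑-insertAt j₀ (λ j → α * c j) _ (A i)) (pivot-identity α (A i j₀) c (A i ∘ punchIn j₀) row)
  eqs : ∀ i → ∑ (suc (suc k)) (λ j → d j * A i j) ≡ 0ℚ
  eqs zero    = trans (expand zero) (∑-zero (suc k) (λ j → pivot-zero α (c j) (row j)))
  eqs (suc i) = trans (expand (suc i)) (proj₂ (proj₂ sol) i)

InAffineHull : ∀ {d k} → (Fin k → Vecℚ d) → Subset d
InAffineHull {k = k} q x = Σ (Fin k → ℚ) λ c → (∑ k c ≡ 1ℚ) × (∀ i → x i ≡ comb c q i)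

-- The affine coordinates of `k + 1` points with respect to `q` satisfy a nontrivial linear
-- relation. Its coefficients sum to zero because the coordinates of each point sum to one, so it is
-- an affine relation.
affine-rank-bound : ∀ {d k} (q : Fin k → Vecℚ d) {S : Subset d} →
                    (∀ x → S x → InAffineHull q x) → ¬ HasAffIndep S (suc k)
affine-rank-bound {d} {k} q S⊆hull (p , Sp , ind) = cj≢0 (ind c vanish total j)
  where
  hull = λ j → S⊆hull (p j) (Sp j)
  C = λ j → proj₁ (hull j)
  sol = nontrivial-solution k (λ l j → C j l)
  c = proj₁ sol
  j = proj₁ (proj₁ (proj₂ sol))
  cj≢0 = proj₂ (proj₁ (proj₂ sol))
  vanish : ∀ i → comb c p i ≡ 0ℚ
  vanish i = begin
    comb c p i                      ≡⟨ ∑-cong (suc k) (λ j → cong (c j *_) (proj₂ (proj₂ (hull j)) i)) ⟩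
    comb c (λ j → comb (C j) q) i   ≡⟨ comb-comb c C q i ⟩
    comb (comb c C) q i             ≡⟨ ∑-zero k (λ l → trans (cong (_* q l i) (proj₂ (proj₂ sol) l)) (ℚ.*-zeroˡ (q l i))) ⟩
    0ℚ ∎
  total : ∑ (suc k) c ≡ 0ℚ
  total = begin
    ∑ (suc k) c                                ≡⟨ ∑-cong (suc k) (λ j → trans (sym (ℚ.*-identityʳ (c j)))
                                                    (cong (c j *_) (sym (proj₁ (proj₂ (hull j)))))) ⟩
    ∑ (suc k) (λ j → c j * ∑ k (C j))          ≡⟨ ∑-cong (suc k) (λ j → sym (∑-*ˡ k (c j) (C j))) ⟩
    ∑ (suc k) (λ j → ∑ k (λ l → c j * C j l))  ≡⟨ ∑-comm (suc k) k (λ j l → c j * C j l) ⟩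
    ∑ k (λ l → ∑ (suc k) (λ j → c j * C j l))  ≡⟨ ∑-zero k (proj₂ (proj₂ sol)) ⟩
    0ℚ ∎

-- The origin and the `d` unit vectors affinely span the whole space.
rank-bound : ∀ {d} (S : Subset d) → ¬ HasAffIndep S (suc (suc d))
rank-bound {d} S = affine-rank-bound ((λ _ → 0ℚ) ◂ δ) {S} λ x _ →
  (1ℚ - ∑ d x) ◂ x ,
  solve 1 (λ s → con 1ℚ :+ (:- s) :+ s := con 1ℚ) refl (∑ d x) ,
  λ i → sym (begin
    (1ℚ - ∑ d x) * 0ℚ + ∑ d (λ j → x j * δ j i) ≡⟨ cong₂ _+_ (ℚ.*-zeroʳ (1ℚ - ∑ d x))
        (∑-cong d (λ j → trans (ℚ.*-comm (x j) _) (cong (_* x j) (δ-sym j i)))) ⟩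
    0ℚ + ∑ d (λ j → δ i j * x j) ≡⟨ ℚ.+-identityˡ _ ⟩
    ∑ d (λ j → δ i j * x j) ≡⟨ ∑-δ i x ⟩
    x i ∎)
  where
  δ-sym : ∀ {n} (i j : Fin n) → δ i j ≡ δ j i
  δ-sym zero    zero    = refl
  δ-sym zero    (suc j) = refl
  δ-sym (suc i) zero    = refl
  δ-sym (suc i) (suc j) = δ-sym i j

-- Evaluating `a - β` on an affine relation kills every term except that of the new point, where the
-- value is nonzero.
AffIndep-◂ : ∀ {d k} {p : Fin k → Vecℚ d} {q : Vecℚ d} (a : Vecℚ d) (β : ℚ) →
             AffIndep p → (∀ j → dot a (p j) ≡ β) → dot a q ≢ β → AffIndep (q ◂ p)
AffIndep-◂ {d} {k} {p} {q} a β ind on off c vanish total = λ { zero → c₀≡0 ; (suc j) → rest j }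
  where
  s = ∑ k (c ∘ suc)
  c₀ = c zero
  value : c₀ * dot a q + s * β ≡ 0ℚ
  value = begin
    c₀ * dot a q + s * β ≡⟨ cong (c₀ * dot a q +_) (trans (sym (∑-*ʳ k β (c ∘ suc)))
                              (∑-cong k (λ j → cong (c (suc j) *_) (sym (on j))))) ⟩
    ∑ (suc k) (λ j → c j * dot a ((q ◂ p) j)) ≡⟨ dot-comb a c (q ◂ p) ⟨
    dot a (comb c (q ◂ p)) ≡⟨ dot-cong a vanish ⟩
    dot a (λ _ → 0ℚ) ≡⟨ ∑-zero d (λ i → ℚ.*-zeroʳ (a i)) ⟩
    0ℚ ∎
  c₀≡0 : c₀ ≡ 0ℚ
  c₀≡0 = *-cancel-zero {dot a q - β} (off ∘ x∙y⁻¹≈ε⇒x≈y (dot a q) β) (begin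
    (dot a q - β) * c₀ ≡⟨ solve 4 (λ x b c s → (x :+ (:- b)) :* c := (c :* x :+ s :* b) :+ (:- b) :* (c :+ s)) refl (dot a q) β c₀ s ⟩
    (c₀ * dot a q + s * β) + - β * (c₀ + s) ≡⟨ cong₂ (λ u v → u + - β * v) value total ⟩
    0ℚ + - β * 0ℚ ≡⟨ trans (ℚ.+-identityˡ _) (ℚ.*-zeroʳ (- β)) ⟩
    0ℚ ∎)
  drop : ∀ {x y} → c₀ * x + y ≡ 0ℚ → y ≡ 0ℚ
  drop {x} {y} eq = trans (sym (trans (cong (_+ y) (trans (cong (_* x) c₀≡0) (ℚ.*-zeroˡ x))) (ℚ.+-identityˡ y))) eq
  rest = ind (c ∘ suc) (λ i → drop (vanish i))
    (trans (sym (trans (cong (_+ s) c₀≡0) (ℚ.+-identityˡ s))) total)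

AffIndep-◂-coord : ∀ {d k} {p : Fin k → Vecℚ d} {q : Vecℚ d} (e : Fin d) →
                   AffIndep p → (∀ j → p j e ≡ 0ℚ) → q e ≢ 0ℚ → AffIndep (q ◂ p)
AffIndep-◂-coord {p = p} {q} e ind on off = AffIndep-◂ {p = p} {q} (δ e) 0ℚ ind
  (λ j → trans (∑-δ e (p j)) (on j)) (off ∘ trans (sym (∑-δ e q)))

LinIndep : {d k : ℕ} → (Fin k → Vecℚ d) → Set
LinIndep {k = k} u = ∀ c → (∀ i → comb c u i ≡ 0ℚ) → ∀ j → c j ≡ 0ℚ

-- Giving `p zero` minus the sum of the other coefficients turns a linear relation of the
-- differences into an affine one of the points.
differences-LinIndep : ∀ {d n} {p : Fin (suc n) → Vecℚ d} → AffIndep p →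
                       LinIndep (λ j i → p (suc j) i - p zero i)
differences-LinIndep {n = n} {p} ind c vanish j = ind (- ∑ n c ◂ c)
  (λ i → trans (begin
    - ∑ n c * p zero i + ∑ n (λ j → c j * p (suc j) i)
      ≡⟨ cong (_+ ∑ n (λ j → c j * p (suc j) i)) (trans
           (solve 2 (λ s x → (:- s) :* x := (:- x) :* s) refl (∑ n c) (p zero i)) (sym (∑-*ˡ n (- p zero i) c))) ⟩
    ∑ n (λ j → - p zero i * c j) + ∑ n (λ j → c j * p (suc j) i)
      ≡⟨ ∑-+ n (λ j → - p zero i * c j) (λ j → c j * p (suc j) i) ⟨
    ∑ n (λ j → - p zero i * c j + c j * p (suc j) i)
      ≡⟨ ∑-cong n (λ j → solve 3 (λ x c y → (:- x) :* c :+ c :* y := c :* (y :+ (:- x))) refl (p zero i) (c j) (p (suc j) i)) ⟩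
    ∑ n (λ j → c j * (p (suc j) i - p zero i)) ∎) (vanish i))
  (ℚ.+-inverseˡ (∑ n c)) (suc j)

-- The coefficients sum to zero, so the contributions of `h` cancel and a linear relation of `w`
-- remains.
translate-AffIndep : ∀ {d n} (h : Vecℚ d) {w : Fin n → Vecℚ d} → LinIndep w →
                     AffIndep (h ◂ (λ j i → h i + w j i))
translate-AffIndep {n = n} h {w} ind c vanish total = λ { zero → c₀≡0 ; (suc j) → rest j }
  where
  s = ∑ n (c ∘ suc)
  rest : ∀ j → c (suc j) ≡ 0ℚ
  rest = ind (c ∘ suc) λ i → begin
    comb (c ∘ suc) w i
      ≡⟨ solve 4 (λ c s h t → t := (:- h) :* (c :+ s) :+ (c :* h :+ (h :* s :+ t))) refl (c zero) s (h i) (comb (c ∘ suc) w i) ⟩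
    - h i * (c zero + s) + (c zero * h i + (h i * s + comb (c ∘ suc) w i))
      ≡⟨ cong (λ t → - h i * (c zero + s) + (c zero * h i + t)) (begin
           h i * s + comb (c ∘ suc) w i ≡⟨ cong (_+ comb (c ∘ suc) w i) (∑-*ˡ n (h i) (c ∘ suc)) ⟨
           ∑ n (λ j → h i * c (suc j)) + comb (c ∘ suc) w i ≡⟨ ∑-+ n (λ j → h i * c (suc j)) (λ j → c (suc j) * w j i) ⟨
           ∑ n (λ j → h i * c (suc j) + c (suc j) * w j i)
             ≡⟨ ∑-cong n (λ j → solve 3 (λ h c w → h :* c :+ c :* w := c :* (h :+ w)) refl (h i) (c (suc j)) (w j i)) ⟩
           ∑ n (λ j → c (suc j) * (h i + w j i)) ∎) ⟩
    - h i * (c zero + s) + (c zero * h i + ∑ n (λ j → c (suc j) * (h i + w j i)))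
      ≡⟨ cong₂ (λ u v → - h i * u + v) total (vanish i) ⟩
    - h i * 0ℚ + 0ℚ ≡⟨ trans (ℚ.+-identityʳ _) (ℚ.*-zeroʳ (- h i)) ⟩
    0ℚ ∎
  c₀≡0 : c zero ≡ 0ℚ
  c₀≡0 = trans (sym (trans (cong (c zero +_) (∑-zero n rest)) (ℚ.+-identityʳ (c zero)))) total

-- Intersecting with a coordinate hyperplane costs at most one dimension. The combinations are
-- recorded so that membership in a subspace passes from `u` to `w`.
hyperplane-section : ∀ {d n} {u : Fin (suc n) → Vecℚ d} → LinIndep u → (e : Fin d) →
  Σ (Fin n → Vecℚ d) λ w → LinIndep w × (∀ j → w j e ≡ 0ℚ) ×
  (∀ j → Σ (Fin (suc n) → ℚ) λ c → ∀ i → w j i ≡ comb c u i)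
hyperplane-section {d} {n} {u} ind e with any? (λ j → ¬? (u j e ≟ 0ℚ))
-- All vectors already lie in the hyperplane; one is dropped only to get the count right.
... | no all-zero = u ∘ suc , ind′ , (λ j → decidable-stable (u (suc j) e ≟ 0ℚ) (λ ne → all-zero (suc j , ne))) ,
                    λ j → δ (suc j) , λ i → sym (∑-δ (suc j) (λ l → u l i))
  where
  ind′ : LinIndep (u ∘ suc)
  ind′ c vanish j = ind (0ℚ ◂ c)
    (λ i → trans (cong (_+ comb c (u ∘ suc) i) (ℚ.*-zeroˡ (u zero i))) (trans (ℚ.+-identityˡ _) (vanish i))) (suc j)
... | yes (j₀ , α≢0) = w , ind′ , (λ j → trans (sym (ℚ.*-identityˡ _)) (pivot-zero α 1ℚ (r j))) , span
  where
  α = u j₀ e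
  r = λ j → u (punchIn j₀ j) e
  w = λ j i → α * u (punchIn j₀ j) i - r j * u j₀ i
  ind′ : LinIndep w
  ind′ c vanish j = *-cancel-zero α≢0 (trans (sym (insertAt-punchIn (λ j → α * c j) j₀ _ j))
    (ind (insertAt (λ j → α * c j) j₀ (- ∑ n (λ j → c j * r j)))
      (λ i → trans (∑-insertAt j₀ (λ j → α * c j) _ (λ l → u l i))
        (trans (pivot-identity α (u j₀ i) c (λ j → u (punchIn j₀ j) i) r) (vanish i)))
      (punchIn j₀ j)))
  span : ∀ j → Σ (Fin (suc n) → ℚ) λ c → ∀ i → w j i ≡ comb c u i
  span j = insertAt (λ l → α * δ j l) j₀ (- r j) , λ i → sym (begin
    ∑ (suc n) (λ l → insertAt (λ l → α * δ j l) j₀ (- r j) l * u l i)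
      ≡⟨ ∑-insertAt j₀ (λ l → α * δ j l) (- r j) (λ l → u l i) ⟩
    - r j * u j₀ i + ∑ n (λ l → α * δ j l * u (punchIn j₀ l) i)
      ≡⟨ cong (- r j * u j₀ i +_) (begin
           ∑ n (λ l → α * δ j l * u (punchIn j₀ l) i) ≡⟨ ∑-cong n (λ l → ℚ.*-assoc α (δ j l) _) ⟩
           ∑ n (λ l → α * (δ j l * u (punchIn j₀ l) i)) ≡⟨ ∑-*ˡ n α (λ l → δ j l * u (punchIn j₀ l) i) ⟩
           α * ∑ n (λ l → δ j l * u (punchIn j₀ l) i) ≡⟨ cong (α *_) (∑-δ j (λ l → u (punchIn j₀ l) i)) ⟩
           α * u (punchIn j₀ j) i ∎) ⟩
    - r j * u j₀ i + α * u (punchIn j₀ j) i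
      ≡⟨ solve 4 (λ r x α y → (:- r) :* x :+ α :* y := α :* y :+ (:- (r :* x))) refl (r j) (u j₀ i) α (u (punchIn j₀ j) i) ⟩
    α * u (punchIn j₀ j) i - r j * u j₀ i ∎)

-- Faces of polyhedra

HasAffIndep-mono : ∀ {d k} {S T : Subset d} → (∀ {x} → S x → T x) → HasAffIndep S k → HasAffIndep T k
HasAffIndep-mono S⊆T (p , Sp , ind) = p , (λ j → S⊆T (Sp j)) , ind

-- A convex combination may use one vertex several times; `comb c (δ ∘ ι)` collects the coefficients
-- that fall on each vertex.
ConvHull⇔ConvHullOf : ∀ {d k} {A : Subset d} {p : Fin k → Vecℚ d} → (∀ j → A (p j)) →
  (∀ x → A x → ∃ λ j → ∀ i → x i ≡ p j i) → ∀ x → ConvHull A x ⇔ ConvHullOf p x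
ConvHull⇔ConvHullOf {k = k} {A} {p} Ap vertex x = mk⇔ to λ { (c , 0≤c , ∑c , x≡) → k , p , c , Ap , 0≤c , ∑c , x≡ }
  where
  to : ConvHull A x → ConvHullOf p x
  to (n , q , c , Aq , 0≤c , ∑c , x≡) = comb c (δ ∘ ι) ,
    (λ l → ∑-nonneg n (λ j → *-nonneg (0≤c j) (δ-nonneg (ι j) l))) ,
    total ,
    λ i → begin
      x i ≡⟨ x≡ i ⟩
      comb c q i ≡⟨ ∑-cong n (λ j → cong (c j *_) (trans (q≡p j i) (sym (∑-δ (ι j) (λ l → p l i))))) ⟩
      comb c (λ j → comb (δ (ι j)) p) i ≡⟨ comb-comb c (δ ∘ ι) p i ⟩
      comb (comb c (δ ∘ ι)) p i ∎
    where
    ι = λ j → proj₁ (vertex (q j) (Aq j))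
    q≡p = λ j → proj₂ (vertex (q j) (Aq j))
    total : ∑ k (comb c (δ ∘ ι)) ≡ 1ℚ
    total = begin
      ∑ k (λ l → ∑ n (λ j → c j * δ (ι j) l)) ≡⟨ ∑-comm n k (λ j l → c j * δ (ι j) l) ⟨
      ∑ n (λ j → ∑ k (λ l → c j * δ (ι j) l))
        ≡⟨ ∑-cong n (λ j → trans (∑-*ˡ k (c j) (δ (ι j))) (trans (cong (c j *_) (∑-δ-total (ι j))) (ℚ.*-identityʳ (c j)))) ⟩
      ∑ n c ≡⟨ ∑c ⟩
      1ℚ    ∎

-- The empty family is independent, and without a rank each attainable size would make the next one
-- attainable, up to a size excluded by `rank-bound`.
¬¬-AffRank : ∀ {d} (S : Subset d) → ¬ ¬ ∃ (AffRank S)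
¬¬-AffRank {d} S no-rank = grow (suc (suc d)) (rank-bound S)
  where
  grow : ∀ n → ¬ ¬ HasAffIndep S n
  grow zero    none = none ((λ ()) , (λ ()) , λ _ _ _ ())
  grow (suc n) none = grow n (λ has → no-rank (n , has , none))

AffIndep-punchIn : ∀ {d k} {p : Fin (suc k) → Vecℚ d} (m : Fin (suc k)) →
                   AffIndep p → AffIndep (p ∘ punchIn m)
AffIndep-punchIn {k = k} {p} m ind c vanish total j =
  trans (sym (insertAt-punchIn c m 0ℚ j))
    (ind (insertAt c m 0ℚ)
      (λ i → trans (∑-insertAt m c 0ℚ (λ l → p l i)) (trans (drop (p m i)) (vanish i)))
      (begin
        ∑ (suc k) (insertAt c m 0ℚ) ≡⟨ ∑-cong (suc k) (λ j → ℚ.*-identityʳ (insertAt c m 0ℚ j)) ⟨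
        ∑ (suc k) (λ j → insertAt c m 0ℚ j * 1ℚ) ≡⟨ ∑-insertAt m c 0ℚ (λ _ → 1ℚ) ⟩
        0ℚ * 1ℚ + ∑ k (λ j → c j * 1ℚ) ≡⟨ drop 1ℚ ⟩
        ∑ k (λ j → c j * 1ℚ) ≡⟨ ∑-cong k (λ j → ℚ.*-identityʳ (c j)) ⟩
        ∑ k c ≡⟨ total ⟩
        0ℚ ∎)
      (punchIn m j))
  where
  drop : ∀ x {y} → 0ℚ * x + y ≡ y
  drop x {y} = trans (cong (_+ y) (ℚ.*-zeroˡ x)) (ℚ.+-identityˡ y)

-p≤∣p∣ : ∀ p → - p ≤ ∣ p ∣
-p≤∣p∣ p with ℚ.∣p∣≡p∨∣p∣≡-p p
... | inj₁ eq = ℚ.≤-trans (ℚ.neg-antimono-≤ (ℚ.∣p∣≡p⇒0≤p eq)) (ℚ.0≤∣p∣ p)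
... | inj₂ eq = ℚ.≤-reflexive (sym eq)

-q≤p⇒0≤p+q : ∀ {p q} → - q ≤ p → 0ℚ ≤ p + q
-q≤p⇒0≤p+q {p} {q} le = subst (_≤ p + q) (ℚ.+-inverseˡ q) (ℚ.+-monoˡ-≤ q le)

-- Finiteness of the index set allows the double negation to be moved outside, one index at a time.
¬¬-∀ : ∀ {n} {A : Fin n → Set} → (∀ i → ¬ ¬ A i) → ¬ ¬ (∀ i → A i)
¬¬-∀ {zero}  nn none = none λ ()
¬¬-∀ {suc n} nn none = nn zero λ a₀ → ¬¬-∀ (nn ∘ suc) λ as → none λ { zero → a₀ ; (suc i) → as i }

-- The choice `m = 2 + x / y` gives `m * y = x + 2 * y`.
large-multiple : ∀ {x y} → 0ℚ ≤ x → 0ℚ ≤ y → y ≢ 0ℚ → ∃ λ m → (1ℚ + 1ℚ ≤ m) × (x ≤ m * y)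
large-multiple {x} {y} 0≤x 0≤y y≢0 =
  1ℚ + 1ℚ + x * 1/ y ,
  subst (_≤ 1ℚ + 1ℚ + x * 1/ y) (ℚ.+-identityʳ (1ℚ + 1ℚ)) (ℚ.+-monoʳ-≤ (1ℚ + 1ℚ) (*-nonneg 0≤x 0≤1/y)) ,
  subst₂ _≤_ (ℚ.+-identityʳ x) eq (ℚ.+-monoʳ-≤ x (ℚ.+-mono-≤ 0≤y 0≤y))
  where
  instance
    y-positive : Positive y
    y-positive = ℚ.nonNeg∧nonZero⇒pos y {{nonNegative 0≤y}} {{≢-nonZero y≢0}}
    y-nonZero = ℚ.pos⇒nonZero y
  0≤1/y : 0ℚ ≤ 1/ y
  0≤1/y = ℚ.<⇒≤ (ℚ.positive⁻¹ (1/ y) {{ℚ.1/pos⇒pos y}})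
  eq : x + (y + y) ≡ (1ℚ + 1ℚ + x * 1/ y) * y
  eq = begin
    x + (y + y)                     ≡⟨ cong (_+ (y + y)) (ℚ.*-identityʳ x) ⟨
    x * 1ℚ + (y + y)                ≡⟨ cong (λ u → x * u + (y + y)) (ℚ.*-inverseˡ y) ⟨
    x * (1/ y * y) + (y + y)        ≡⟨ solve 3 (λ x y z → x :* (z :* y) :+ (y :+ y) := (con 1ℚ :+ con 1ℚ :+ x :* z) :* y) refl x y (1/ y) ⟩
    (1ℚ + 1ℚ + x * 1/ y) * y ∎

-- Serves to keep `M * h + w` in the nonnegative orthant: at `e` both sides vanish, and elsewhere
-- the factor `h i` is at least 1.
scaled-bound : ∀ {d} {e : Fin d} {M} {h v : Vecℚ d} → 0ℚ ≤ M → h e ≡ 0ℚ → (∀ i → i ≢ e → 1ℚ ≤ h i) →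
               v e ≡ 0ℚ → (∀ i → v i ≤ M) → ∀ i → v i ≤ M * h i
scaled-bound {e = e} {M} {h} {v} 0≤M he≡0 1≤h ve≡0 v≤M i with i ≟ᶠ e
... | yes refl = ℚ.≤-reflexive (trans ve≡0 (sym (trans (cong (M *_) he≡0) (ℚ.*-zeroʳ M))))
... | no i≢e   = ℚ.≤-trans (v≤M i) (subst (_≤ M * h i) (ℚ.*-identityʳ M)
  (ℚ.*-monoˡ-≤-nonNeg M {{nonNegative 0≤M}} (1≤h i i≢e)))

-- Evaluating `a - b` at `x` leaves the coefficient of `p m` times a nonzero number, so this
-- coefficient is zero.
InAffineHull-face : ∀ {d k} {p : Fin (suc k) → Vecℚ d} (a : Vecℚ d) (b : ℚ) (m : Fin (suc k)) →
  dot a (p m) ≢ b → (∀ j → dot a (p (punchIn m j)) ≡ b) →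
  ∀ {x} → InAffineHull p x → dot a x ≡ b → InAffineHull (p ∘ punchIn m) x
InAffineHull-face {k = k} {p} a b m off on {x} (c , ∑c , x≡) ax≡b =
  c ∘ punchIn m , trans (sym (drop-m c cm≡0)) ∑c ,
  λ i → trans (x≡ i) (drop-m (λ j → c j * p j i) (trans (cong (_* p m i) cm≡0) (ℚ.*-zeroˡ (p m i))))
  where
  s = ∑ k (c ∘ punchIn m)
  total : c m + s ≡ 1ℚ
  total = trans (sym (∑-remove m c)) ∑c
  value : c m * dot a (p m) + s * b ≡ b
  value = begin
    c m * dot a (p m) + s * b
      ≡⟨ cong (c m * dot a (p m) +_) (trans (sym (∑-*ʳ k b (c ∘ punchIn m)))
           (∑-cong k (λ j → cong (c (punchIn m j) *_) (sym (on j))))) ⟩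
    c m * dot a (p m) + ∑ k (λ j → c (punchIn m j) * dot a (p (punchIn m j)))
      ≡⟨ ∑-remove m (λ j → c j * dot a (p j)) ⟨
    ∑ (suc k) (λ j → c j * dot a (p j)) ≡⟨ dot-comb a c p ⟨
    dot a (comb c p)                    ≡⟨ dot-cong a x≡ ⟨
    dot a x                             ≡⟨ ax≡b ⟩
    b                                   ∎
  cm≡0 : c m ≡ 0ℚ
  cm≡0 = *-cancel-zero {dot a (p m) - b} (off ∘ x∙y⁻¹≈ε⇒x≈y (dot a (p m)) b) (begin
    (dot a (p m) - b) * c m
      ≡⟨ solve 4 (λ x b c s → (x :+ (:- b)) :* c := (c :* x :+ s :* b) :+ (:- b) :* (c :+ s)) refl (dot a (p m)) b (c m) s ⟩
    (c m * dot a (p m) + s * b) + - b * (c m + s) ≡⟨ cong₂ (λ u v → u + - b * v) value total ⟩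
    b + - b * 1ℚ ≡⟨ solve 1 (λ b → b :+ (:- b) :* con 1ℚ := con 0ℚ) refl b ⟩
    0ℚ           ∎)
  drop-m : ∀ (f : Fin (suc k) → ℚ) → f m ≡ 0ℚ → ∑ (suc k) f ≡ ∑ k (f ∘ punchIn m)
  drop-m f fm≡0 = trans (∑-remove m f) (trans (cong (_+ ∑ k (f ∘ punchIn m)) fm≡0) (ℚ.+-identityˡ _))

-- K is a linear subspace; without function extensionality, K-comb also has to say that membership
-- respects pointwise equality.
module Polyhedral {d : ℕ} (K : Subset d)
  (K-comb : ∀ {k} (c : Fin k → ℚ) (p : Fin k → Vecℚ d) {x} →
            (∀ j → K (p j)) → (∀ i → x i ≡ comb c p i) → K x) where

  Cone : Subset d
  Cone x = (∀ i → 0ℚ ≤ x i) × K x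

  K-lin : ∀ s t {x y z} → K x → K y → (∀ i → z i ≡ s * x i + t * y i) → K z
  K-lin s t {x} {y} Kx Ky eq = K-comb (s ◂ t ◂ ◂[]) (x ◂ y ◂ ◂[]) (λ { zero → Kx ; (suc zero) → Ky })
    (λ i → trans (eq i) (cong (s * x i +_) (sym (ℚ.+-identityʳ (t * y i)))))

  -- Adding `g` raises the rank of the face by one. Conversely, the differences of an independent
  -- family of the cone, cut down to the hyperplane, are directions that stay in the face when
  -- started at a large multiple of `h`. The double negation comes from the rank of the face.
  coordinate-facet : ∀ {e h g} → Cone h → h e ≡ 0ℚ → (∀ i → i ≢ e → 1ℚ ≤ h i) → Cone g → g e ≢ 0ℚ →
                     ¬ ¬ IsFacet Cone (λ x → Cone x × x e ≡ 0ℚ)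
  coordinate-facet {e} {h} {g} (_ , Kh) he≡0 1≤h Cg ge≢0 not-facet =
    ¬¬-AffRank Face λ { (r , has , max) → not-facet (face , r , (upper has , lower max) , (has , max)) }
    where
    Face : Subset d
    Face x = Cone x × x e ≡ 0ℚ
    value : ∀ x → dot (λ i → - δ e i) x ≡ - x e
    value x = trans (∑-cong d (λ i → solve 2 (λ u v → (:- u) :* v := u :* (:- v)) refl (δ e i) (x i)))
                    (∑-δ e (λ i → - x i))
    face : IsFace Cone Face
    -- The sign turns `0 ≤ x e` into an upper bound, as `IsFace` expects.
    face = (λ i → - δ e i) , 0ℚ ,
      (λ x Cx → subst (_≤ 0ℚ) (sym (value x)) (ℚ.neg-antimono-≤ (proj₁ Cx e))) ,
      (λ x → mk⇔ (λ { (Cx , xe≡0) → Cx , trans (value x) (cong -_ xe≡0) })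
                  (λ { (Cx , eq) → Cx , ℚ.neg-injective (trans (sym (value x)) eq) }))
    upper : ∀ {r} → HasAffIndep Face r → HasAffIndep Cone (suc r)
    upper (p , Fp , ind) = g ◂ p , (λ { zero → Cg ; (suc j) → proj₁ (Fp j) }) ,
      AffIndep-◂-coord {p = p} {g} e ind (proj₂ ∘ Fp) ge≢0
    lower : ∀ {r} → ¬ HasAffIndep Face (suc r) → ¬ HasAffIndep Cone (suc (suc r))
    -- The `r + 2` points have `r + 1` differences, of which the section leaves `r` directions; the
    -- base point restores the count to `r + 1`.
    lower {r} max (p , Cp , ind) = max (base ◂ (λ j i → base i + w j i) ,
      (λ { zero → ((λ i → base-nonneg i) , K-base) , base-e
         ; (suc j) → ((λ i → -q≤p⇒0≤p+q (w≤base j i)) ,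
                      K-lin 1ℚ 1ℚ K-base (Kw j) (λ i → cong₂ _+_ (sym (ℚ.*-identityˡ (base i))) (sym (ℚ.*-identityˡ (w j i))))) ,
                     trans (cong₂ _+_ base-e (w-e j)) (ℚ.+-identityˡ 0ℚ) }) ,
      translate-AffIndep base w-ind)
      where
      section = hyperplane-section {u = λ j i → p (suc j) i - p zero i} (differences-LinIndep {p = p} ind) e
      w = proj₁ section
      w-ind = proj₁ (proj₂ section)
      w-e = proj₁ (proj₂ (proj₂ section))
      w-span = proj₂ (proj₂ (proj₂ section))
      Kw : ∀ j → K (w j)
      Kw j = K-comb (proj₁ (w-span j)) (λ j i → p (suc j) i - p zero i)
        (λ l → K-lin 1ℚ (- 1ℚ) (proj₂ (Cp (suc l))) (proj₂ (Cp zero))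
          (λ i → solve 2 (λ x y → x :+ (:- y) := con 1ℚ :* x :+ (:- con 1ℚ) :* y) refl (p (suc l) i) (p zero i)))
        (proj₂ (w-span j))
      -- A crude common bound for the absolute values of all entries of `w`.
      M = ∑ r (λ j → ∑ d (λ i → ∣ w j i ∣))
      0≤M : 0ℚ ≤ M
      0≤M = ∑-nonneg r (λ j → ∑-nonneg d (λ i → ℚ.0≤∣p∣ (w j i)))
      base : Vecℚ d
      base i = M * h i
      base-e : base e ≡ 0ℚ
      base-e = trans (cong (M *_) he≡0) (ℚ.*-zeroʳ M)
      K-base : K base
      K-base = K-lin M 0ℚ Kh Kh (λ i → sym (trans (cong (M * h i +_) (ℚ.*-zeroˡ (h i))) (ℚ.+-identityʳ (M * h i))))
      base-nonneg : ∀ i → 0ℚ ≤ base i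
      base-nonneg = scaled-bound {h = h} {λ _ → 0ℚ} 0≤M he≡0 1≤h refl (λ _ → 0≤M)
      w≤base : ∀ j i → - w j i ≤ base i
      w≤base j = scaled-bound {h = h} {λ i → - w j i} 0≤M he≡0 1≤h (cong -_ (w-e j)) λ i →
        ℚ.≤-trans (-p≤∣p∣ (w j i)) (ℚ.≤-trans
          (≤∑ (λ i → ∣ w j i ∣) (λ i → ℚ.0≤∣p∣ (w j i)) i)
          (≤∑ (λ j → ∑ d (λ i → ∣ w j i ∣)) (λ j → ∑-nonneg d (λ i → ℚ.0≤∣p∣ (w j i))) j))

  -- Slices of the cone by a linear functional.

  module Slice (Ω : Vecℚ d → ℚ)
    (Ω-comb : ∀ {k} (c : Fin k → ℚ) (p : Fin k → Vecℚ d) {x} →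
              (∀ i → x i ≡ comb c p i) → Ω x ≡ ∑ k (λ j → c j * Ω (p j))) where

    P : Subset d
    P x = Cone x × Ω x ≡ 1ℚ

    -- Homogenisation: division by `Ω f` moves `f` into the slice, where `valid` applies.
    cone-inequality : ∀ {a b} → (∀ x → P x → dot a x ≤ b) →
                      ∀ {f} → Cone f → 0ℚ < Ω f → dot a f ≤ b * Ω f
    cone-inequality {a} {b} valid {f} (0≤f , Kf) 0<t =
      subst (_≤ b * t) back (ℚ.*-monoʳ-≤-nonNeg t {{ℚ.pos⇒nonNeg t}} (valid y ((0≤y , Ky) , Ωy)))
      where
      t = Ω f
      instance
        t-positive = positive 0<t
        t-nonZero = ℚ.pos⇒nonZero t
      y : Vecℚ d
      y i = 1/ t * f i
      y-comb : ∀ i → y i ≡ comb ((1/ t) ◂ ◂[]) (f ◂ ◂[]) i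
      y-comb i = sym (ℚ.+-identityʳ (y i))
      0≤y : ∀ i → 0ℚ ≤ y i
      0≤y i = *-nonneg (ℚ.<⇒≤ (ℚ.positive⁻¹ (1/ t) {{ℚ.1/pos⇒pos t}})) (0≤f i)
      Ky = K-comb ((1/ t) ◂ ◂[]) (f ◂ ◂[]) (λ { zero → Kf }) y-comb
      Ωy : Ω y ≡ 1ℚ
      Ωy = trans (Ω-comb ((1/ t) ◂ ◂[]) (f ◂ ◂[]) y-comb) (trans (ℚ.+-identityʳ (1/ t * t)) (ℚ.*-inverseˡ t))
      back : dot a y * t ≡ dot a f
      back = begin
        dot a y * t ≡⟨ cong (_* t) (trans (∑-cong d (λ i → x∙yz≈y∙xz (a i) (1/ t) (f i))) (∑-*ˡ d (1/ t) (λ i → a i * f i))) ⟩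
        1/ t * dot a f * t ≡⟨ solve 3 (λ s x t → s :* x :* t := (s :* t) :* x) refl (1/ t) (dot a f) t ⟩
        1/ t * t * dot a f ≡⟨ trans (cong (_* dot a f) (ℚ.*-inverseˡ t)) (ℚ.*-identityˡ (dot a f)) ⟩
        dot a f ∎

    -- Without coordinates `x` would be the empty combination, with `Ω x ≡ 0ℚ`. The index found
    -- gives the lower bound on `T` in `full-support⇒whole`.
    inhabited : ∀ {x} → Ω x ≡ 1ℚ → Fin d
    inhabited {x} Ωx = decide d refl
      where
      -- The dimension is a fixed module parameter, hence the match on a variable equal to it.
      decide : ∀ n → n ≡ d → Fin d
      decide (suc n) refl = zero
      decide zero    refl = contradiction (trans (sym Ωx) (Ω-comb ◂[] ◂[] λ ())) ℚ.1≢0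

    -- A large enough combination z of the given points keeps z - x in the cone, which reverses the inequality
    -- at x; coefficients of at least 2 make Ω (z - x) positive.
    full-support⇒whole : ∀ {a b} → (∀ x → P x → dot a x ≤ b) →
      (∀ e → Σ (Vecℚ d) λ y → (P y × dot a y ≡ b) × y e ≢ 0ℚ) → ∀ x → P x → dot a x ≡ b
    full-support⇒whole {a} {b} valid support x Px@((0≤x , Kx) , Ωx) =
      -- Adding `b + dot a x - b * T` to both sides turns `dot a u ≤ b * Ω u` into `b ≤ dot a x`.
      ℚ.≤-antisym (valid x Px) (subst₂ _≤_ lhs rhs (ℚ.+-monoˡ-≤ (b + dot a x - b * T) (cone-inequality {a} valid Cu 0<Ωu)))
      where
      y = λ e → proj₁ (support e)
      Py = λ e → proj₁ (proj₁ (proj₂ (support e)))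
      large = λ e → large-multiple (0≤x e) (proj₁ (proj₁ (Py e)) e) (proj₂ (proj₂ (support e)))
      m = λ e → proj₁ (large e)
      T = ∑ d m
      2≤m = λ e → proj₁ (proj₂ (large e))
      0≤m : ∀ e → 0ℚ ≤ m e
      0≤m e = ℚ.≤-trans (ℚ.nonNegative⁻¹ (1ℚ + 1ℚ)) (2≤m e)
      u = comb (- 1ℚ ◂ m) (x ◂ y)
      0≤u : ∀ i → 0ℚ ≤ u i
      0≤u i = subst (0ℚ ≤_) (ℚ.+-comm (comb m y i) (- 1ℚ * x i)) (-q≤p⇒0≤p+q
        (subst (_≤ comb m y i) (solve 1 (λ x → x := :- ((:- con 1ℚ) :* x)) refl (x i))
          (ℚ.≤-trans (proj₂ (proj₂ (large i)))
            (≤∑ (λ e → m e * y e i) (λ e → *-nonneg (0≤m e) (proj₁ (proj₁ (Py e)) i)) i))))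
      Cu : Cone u
      Cu = 0≤u , K-comb (- 1ℚ ◂ m) (x ◂ y) (λ { zero → Kx ; (suc e) → proj₂ (proj₁ (Py e)) }) (λ _ → refl)
      Ωu : Ω u ≡ T - 1ℚ
      Ωu = begin
        Ω u ≡⟨ Ω-comb (- 1ℚ ◂ m) (x ◂ y) (λ _ → refl) ⟩
        - 1ℚ * Ω x + ∑ d (λ e → m e * Ω (y e))
          ≡⟨ cong₂ _+_ (cong (- 1ℚ *_) Ωx) (∑-cong d (λ e → trans (cong (m e *_) (proj₂ (Py e))) (ℚ.*-identityʳ (m e)))) ⟩
        - 1ℚ + T ≡⟨ ℚ.+-comm (- 1ℚ) T ⟩
        T - 1ℚ ∎
      0<Ωu : 0ℚ < Ω u
      0<Ωu = subst (0ℚ <_) (sym Ωu) (ℚ.<-≤-trans (ℚ.positive⁻¹ 1ℚ)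
        (ℚ.+-monoˡ-≤ (- 1ℚ) (ℚ.≤-trans (2≤m e) (≤∑ m 0≤m e))))
        where e = inhabited {x} Ωx
      dot-u : dot a u ≡ - 1ℚ * dot a x + T * b
      dot-u = trans (dot-comb a (- 1ℚ ◂ m) (x ◂ y)) (cong (- 1ℚ * dot a x +_)
        (trans (∑-cong d (λ e → cong (m e *_) (proj₂ (proj₁ (proj₂ (support e)))))) (∑-*ʳ d b m)))
      lhs : dot a u + (b + dot a x - b * T) ≡ b
      lhs = trans (cong (_+ (b + dot a x - b * T)) dot-u)
        (solve 3 (λ x t b → (:- con 1ℚ) :* x :+ t :* b :+ (b :+ x :+ (:- (b :* t))) := b) refl (dot a x) T b)
      rhs : b * Ω u + (b + dot a x - b * T) ≡ dot a x
      rhs = trans (cong (λ w → b * w + (b + dot a x - b * T)) Ωu)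
        (solve 3 (λ x t b → b :* (t :+ (:- con 1ℚ)) :+ (b :+ x :+ (:- (b :* t))) := x) refl (dot a x) T b)

    -- If every coordinate were nonzero somewhere on `F`, full support would make `F` all of `P`,
    -- which contains one more independent point than `F` admits.
    facet-on-coordinate-hyperplane : ∀ {F} → IsFacet P F → ¬ ¬ ∃ λ e → ∀ y → F y → y e ≡ 0ℚ
    facet-on-coordinate-hyperplane {F} ((a , b , valid , F⇔) , r , (hasP , _) , (_ , maxF)) none =
      ¬¬-∀ {A = λ e → Σ (Vecℚ d) λ y → (P y × dot a y ≡ b) × y e ≢ 0ℚ}
        (λ e no-y → none (e , λ y Fy → decidable-stable (y e ≟ 0ℚ) λ ye≢0 →
          no-y (y , Equivalence.to (F⇔ y) Fy , ye≢0)))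
        (λ support → maxF (HasAffIndep-mono {S = P} {F} (λ {x} Px →
          Equivalence.from (F⇔ x) (Px , full-support⇒whole {a} valid support x Px)) hasP))

    -- `private-vertex` abstracts the partition of the edges by the exceptional routes.
    module _ {k : ℕ} (p : Fin k → Vecℚ d) (Pp : ∀ j → P (p j))
      (private-vertex : ∀ e → ¬ ¬ ∃ λ j → p j e ≢ 0ℚ × (∀ i → i ≢ j → p i e ≡ 0ℚ)) where

      hull⊆P : ∀ {x} → ConvHullOf p x → P x
      hull⊆P {x} (c , 0≤c , ∑c , x≡) =
        ((λ i → subst (0ℚ ≤_) (sym (x≡ i)) (∑-nonneg k (λ j → *-nonneg (0≤c j) (proj₁ (proj₁ (Pp j)) i)))) ,
         K-comb c p (λ j → proj₂ (proj₁ (Pp j))) x≡) ,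
        trans (Ω-comb c p x≡) (trans
          (∑-cong k (λ j → trans (cong (c j *_) (proj₂ (Pp j))) (ℚ.*-identityʳ (c j)))) ∑c)

      vertex∈hull : ∀ j → ConvHullOf p (p j)
      vertex∈hull j = δ j , δ-nonneg j , ∑-δ-total j , λ i → sym (∑-δ j (λ l → p l i))

      -- Otherwise the facet would contain all vertices, among them one that is nonzero in the
      -- coordinate vanishing on the facet.
      facet-misses-a-vertex : ∀ {F} ((face , _) : IsFacet P F) →
        ∃ λ m → dot (proj₁ face) (p m) ≢ proj₁ (proj₂ face)
      facet-misses-a-vertex facet@((a , b , _ , F⇔) , _) with any? (λ j → ¬? (dot a (p j) ≟ b))
      ... | yes missed = missed
      ... | no none = contradiction (λ { (e , F⇒0) → private-vertex e λ { (j , pje≢0 , _) →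
              pje≢0 (F⇒0 (p j) (Equivalence.from (F⇔ (p j))
                (Pp j , decidable-stable (dot a (p j) ≟ b) (λ ne → none (j , ne))))) } })
              (facet-on-coordinate-hyperplane facet)

      -- Two missed vertices would extend an affine basis of the facet by two points: the one vanishing on
      -- the coordinate e of the facet first, then the vertex that does not vanish there.
      facet-misses-one-vertex : ∀ {F} ((face , _) : IsFacet P F) {m} →
        dot (proj₁ face) (p m) ≢ proj₁ (proj₂ face) → ∀ i → i ≢ m → dot (proj₁ face) (p i) ≡ proj₁ (proj₂ face)
      facet-misses-one-vertex {F} facet@((a , b , _ , F⇔) , r , (_ , maxP) , ((q , Fq , q-ind) , _)) {m} m-off i i≢m =
        decidable-stable (dot a (p i) ≟ b) λ i-off →
          facet-on-coordinate-hyperplane facet λ { (e , F⇒0) → private-vertex e λ { (j , pje≢0 , others) →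
            let l , l≢j , l-off = pick i-off j in
            maxP (p j ◂ p l ◂ q ,
                  (λ { zero → Pp j ; (suc zero) → Pp l ; (suc (suc t)) → proj₁ (Equivalence.to (F⇔ (q t)) (Fq t)) }) ,
                  AffIndep-◂-coord {p = p l ◂ q} {p j} e
                    (AffIndep-◂ {p = q} {p l} a b q-ind (λ t → proj₂ (Equivalence.to (F⇔ (q t)) (Fq t))) l-off)
                    (λ { zero → others l l≢j ; (suc t) → F⇒0 (q t) (Fq t) })
                    pje≢0) } }
        where
        -- The missed vertices `i` and `m` are distinct, so one of them differs from `j`.
        pick : dot a (p i) ≢ b → ∀ j → ∃ λ l → l ≢ j × dot a (p l) ≢ b
        pick i-off j with i ≟ᶠ j
        ... | no i≢j   = i , i≢j , i-off
        ... | yes refl = m , (λ eq → i≢m (sym eq)) , m-off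

    -- Exactly one vertex `m` is missed, so `F` cuts out the face of the simplex on the remaining
    -- vertices and the rank drops by one. An empty vertex family cannot occur, since some vertex
    -- must be missed.
    facet-of-simplex : ∀ {k} (p : Fin k → Vecℚ d) → AffIndep p → (∀ j → P (p j)) →
      (∀ e → ¬ ¬ ∃ λ j → p j e ≢ 0ℚ × (∀ i → i ≢ j → p i e ≡ 0ℚ)) →
      ∀ {S} → (∀ x → S x ⇔ ConvHullOf p x) → ∀ F → IsFacet P F → IsFacet S (λ x → F x × S x)
    facet-of-simplex {zero} p ind Pp pv S⇔ F facet = contradiction (proj₁ (facet-misses-a-vertex p Pp pv facet)) λ ()
    facet-of-simplex {suc k} p ind Pp pv {S} S⇔ F facet@((a , b , valid , F⇔) , _) =
      (a , b , (λ x Sx → valid x (S⊆P Sx)) ,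
        λ x → mk⇔ (λ { (Fx , Sx) → Sx , proj₂ (Equivalence.to (F⇔ x) Fx) })
                  (λ { (Sx , eq) → Equivalence.from (F⇔ x) (S⊆P Sx , eq) , Sx })) ,
      k , ((p , S-vertex , ind) , affine-rank-bound p {S} S⊆hull) ,
      ((p ∘ punchIn m , (λ j → Equivalence.from (F⇔ _) (Pp _ , on (punchIn m j) (punchInᵢ≢i m j)) , S-vertex _) ,
        AffIndep-punchIn {p = p} m ind) ,
       affine-rank-bound (p ∘ punchIn m) {λ x → F x × S x} F⊆hull)
      where
      missed = facet-misses-a-vertex p Pp pv facet
      m = proj₁ missed
      on = facet-misses-one-vertex p Pp pv facet (proj₂ missed)
      S⊆P : ∀ {x} → S x → P x
      S⊆P {x} Sx = hull⊆P p Pp pv (Equivalence.to (S⇔ x) Sx)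
      S-vertex : ∀ j → S (p j)
      S-vertex j = Equivalence.from (S⇔ (p j)) (vertex∈hull p Pp pv j)
      S⊆hull : ∀ x → S x → InAffineHull p x
      S⊆hull x Sx = let c , _ , ∑c , x≡ = Equivalence.to (S⇔ x) Sx in c , ∑c , x≡
      F⊆hull : ∀ x → F x × S x → InAffineHull (p ∘ punchIn m) x
      F⊆hull x (Fx , Sx) = InAffineHull-face {p = p} a b m (proj₂ missed) (λ j → on (punchIn m j) (punchInᵢ≢i m j))
        (S⊆hull x Sx) (proj₂ (Equivalence.to (F⇔ x) Fx))

-- Routes and framings

lookup-injective : ∀ {A : Set} {xs : List A} → Unique xs → ∀ i j → List.lookup xs i ≡ List.lookup xs j → i ≡ j
lookup-injective (_ ∷ _)  zero    zero    _  = refl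
lookup-injective (x≢ ∷ _) zero    (suc j) eq = contradiction eq (All.lookup x≢ (∈-lookup j))
lookup-injective (x≢ ∷ _) (suc i) zero    eq = contradiction (sym eq) (All.lookup x≢ (∈-lookup i))
lookup-injective (_ ∷ u)  (suc i) (suc j) eq = cong suc (lookup-injective u i j eq)

other-element : ∀ {n} {Q : Fin n → Set} (xs : List (Fin n)) → length xs ≡ 2 → Unique xs → All Q xs →
                ∀ x → ∃ λ y → Q y × y ≢ x
other-element (a ∷ b ∷ []) _ ((a≢b ∷ []) ∷ _) (Qa ∷ Qb ∷ []) x with a ≟ᶠ x
... | yes refl = b , Qb , a≢b ∘ sym
... | no a≢x   = a , Qa , a≢x

∈⇒length≢0 : ∀ {n} {A : Set} {x : A} {xs : List A} → x ∈ xs → length xs ≡ n → n ≢ 0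
∈⇒length≢0 (here _)  refl ()
∈⇒length≢0 (there _) refl ()

fibre : ∀ {m n} → (Fin m → Fin n) → Fin n → List (Fin m)
fibre {m} f v = filter (λ e → f e ≟ᶠ v) (allFin m)

other-in-fibre : ∀ {m n} (f : Fin m → Fin n) v → length (fibre f v) ≡ 2 → ∀ e → ∃ λ e′ → f e′ ≡ v × e′ ≢ e
other-in-fibre {m} f v two = other-element (fibre f v) two
  (Unique.filter⁺ (λ e → f e ≟ᶠ v) (Unique.allFin⁺ m)) (All.all-filter (λ e → f e ≟ᶠ v) (allFin m))

fibre-nonempty : ∀ {m n} (f : Fin m → Fin n) e → length (fibre f (f e)) ≢ 0
fibre-nonempty f e = ∈⇒length≢0 (∈-filter⁺ (λ e′ → f e′ ≟ᶠ f e) (∈-allFin e) refl) refl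

-- Paths and routes in a full acyclic graph.

module _ (G : Digraph) (acyclic : IsAcyclic G) (full : IsFull G) where
  open Digraph G

  source? : ∀ v → Dec (IsSource G v)
  source? v = inDeg G v ℕ.≟ 0

  sink? : ∀ v → Dec (IsSink G v)
  sink? v = outDeg G v ℕ.≟ 0

  tgt-not-source : ∀ {e v} → tgt e ≡ v → ¬ IsSource G v
  tgt-not-source {e} refl = fibre-nonempty tgt e

  src-not-sink : ∀ {e v} → src e ≡ v → ¬ IsSink G v
  src-not-sink {e} refl = fibre-nonempty src e

  tgt-src-inner : ∀ {e f} → tgt e ≡ src f → IsInner G (src f)
  tgt-src-inner {e} {f} eq = tgt-not-source eq , src-not-sink {f} refl

  -- `e` need not enter `v`, so this yields the alternative to `e` at its head and some incoming
  -- edge at any other inner vertex.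
  other-in : ∀ {v} → IsInner G v → ∀ e → ∃ λ e′ → tgt e′ ≡ v × e′ ≢ e
  other-in {v} inner = other-in-fibre tgt v (proj₁ (full v inner))

  other-out : ∀ {v} → IsInner G v → ∀ e → ∃ λ e′ → src e′ ≡ v × e′ ≢ e
  other-out {v} inner = other-in-fibre src v (proj₂ (full v inner))

  lastEdge-++ : ∀ e es {f fs} → lastEdge G e (es ++ f ∷ fs) ≡ lastEdge G f fs
  lastEdge-++ e []        = refl
  lastEdge-++ e (e′ ∷ es) = lastEdge-++ e′ es

  path-++ : ∀ {e es f fs} → IsPath G (e ∷ es) → tgt (lastEdge G e es) ≡ src f → IsPath G (f ∷ fs) →
            IsPath G (e ∷ es ++ f ∷ fs)
  path-++ [ e ]    eq q = eq ∷ q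
  path-++ (e→ ∷ p) eq q = e→ ∷ path-++ p eq q

  -- The path stops just before `f`: transitivity is then concatenation, and `e ↝ e` is a closed
  -- path, which `acyclic` excludes.
  _↝_ : Fin nE → Fin nE → Set
  e ↝ f = ∃ λ es → IsPath G (e ∷ es) × tgt (lastEdge G e es) ≡ src f

  ↝-edge : ∀ {e f} → tgt e ≡ src f → e ↝ f
  ↝-edge {e} eq = [] , [ e ] , eq

  ↝-trans : ∀ {e f g} → e ↝ f → f ↝ g → e ↝ g
  ↝-trans {e} {f} (es , p , eq) (fs , q , eq′) =
    es ++ f ∷ fs , path-++ p eq q , trans (cong tgt (lastEdge-++ e es)) eq′

  ↝-irrefl : ∀ {e f} → e ≡ f → ¬ e ↝ f
  ↝-irrefl {e} refl (es , p , eq) = acyclic e es p (sym eq)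

  -- On the finite set of edges such an order is well-founded in both directions, so prolonging a
  -- path terminates at a sink and at a source.
  ↝-isStrictPartialOrder : IsStrictPartialOrder _≡_ _↝_
  ↝-isStrictPartialOrder = record
    { isEquivalence = isEquivalence
    ; irrefl        = ↝-irrefl
    ; trans         = ↝-trans
    ; <-resp-≈      = resp₂ _↝_
    }

  ↝-reach : ∀ {e es} → IsPath G (e ∷ es) → All (e ↝_) es
  ↝-reach [ e ]    = []
  ↝-reach (e→ ∷ p) = ↝-edge e→ ∷ All.map (↝-trans (↝-edge e→)) (↝-reach p)

  path-Unique : ∀ {es} → IsPath G es → Unique es
  path-Unique []         = []
  path-Unique [ e ]      = [] ∷ []
  path-Unique p@(_ ∷ p′) = All.map (λ e↝f e≡f → ↝-irrefl e≡f e↝f) (↝-reach p) ∷ path-Unique p′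

  ↝-not-source : ∀ {e f} → e ↝ f → ¬ IsSource G (src f)
  ↝-not-source (_ , _ , eq) = tgt-not-source eq

  ToSink : List (Fin nE) → Set
  ToSink []       = ⊥
  ToSink (e ∷ es) = IsPath G (e ∷ es) × IsSink G (tgt (lastEdge G e es))

  -- `Good` is instantiated by the trivial predicate for arbitrary routes and by `_≢ e` for routes
  -- avoiding `e`.
  module Extension (Good : Fin nE → Set)
    (good-in  : ∀ {v} → IsInner G v → ∃ λ e → tgt e ≡ v × Good e)
    (good-out : ∀ {v} → IsInner G v → ∃ λ e → src e ≡ v × Good e) where

    extend-forward : ∀ e → ∃ λ es → ToSink (e ∷ es) × All Good es
    extend-forward e = go e (spo-noetherian ↝-isStrictPartialOrder e)
      where
      go : ∀ e → Acc (flip _↝_) e → ∃ λ es → ToSink (e ∷ es) × All Good es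
      go e (acc rs) with sink? (tgt e)
      ... | yes sink = [] , ([ e ] , sink) , []
      ... | no ¬sink =
        let f , f-src , good = good-out (tgt-not-source {e} refl , ¬sink)
            es , (p , sink) , goods = go f (rs (↝-edge (sym f-src)))
        in f ∷ es , (sym f-src ∷ p , sink) , good ∷ goods

    extend-backward : ∀ e es → ToSink (e ∷ es) → All Good (e ∷ es) →
      ∃ λ xs → IsRoute G (xs ++ e ∷ es) × All Good (xs ++ e ∷ es)
    extend-backward e es = go e es (spo-wellFounded ↝-isStrictPartialOrder e)
      where
      go : ∀ e es → Acc _↝_ e → ToSink (e ∷ es) → All Good (e ∷ es) →
           ∃ λ xs → IsRoute G (xs ++ e ∷ es) × All Good (xs ++ e ∷ es)
      go e es (acc rs) (p , sink) goods with source? (src e)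
      ... | yes source = [] , (p , source , sink) , goods
      ... | no ¬source =
        let f , f-tgt , good = good-in (¬source , src-not-sink {e} refl)
            xs , route , goods′ = go f (e ∷ es) (rs (↝-edge f-tgt)) (f-tgt ∷ p , sink) (good ∷ goods)
        in xs ∷ʳ f , subst (λ R → IsRoute G R × All Good R) (sym (∷ʳ-++ xs f (e ∷ es))) (route , goods′)

    route-through : ∀ e → Good e → ∃ λ R → IsRoute G R × e ∈ R × All Good R
    route-through e good =
      let es , to-sink , goods = extend-forward e
          xs , route , goods′ = extend-backward e es to-sink (good ∷ goods)
      in xs ++ e ∷ es , route , ∈-++⁺ʳ xs (here refl) , goods′

  -- Characteristic vectors of routes as unit flows.

  weight : (Fin nE → Bool) → Vecℚ nE
  weight B e = if B e then 1ℚ else 0ℚ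

  -- Both sides of `Conservation` and the outflow in `FlowPolytope` are definitionally of this form;
  -- as dot products they are linear.
  restricted-sum : (Fin nE → Bool) → Vecℚ nE → ℚ
  restricted-sum B f = ∑ nE (λ e → if B e then f e else 0ℚ)

  restricted-sum≡dot : ∀ B f → restricted-sum B f ≡ dot (weight B) f
  restricted-sum≡dot B f = ∑-cong nE λ e → pointwise (B e) (f e)
    where
    pointwise : ∀ b x → (if b then x else 0ℚ) ≡ (if b then 1ℚ else 0ℚ) * x
    pointwise true  x = sym (ℚ.*-identityˡ x)
    pointwise false x = sym (ℚ.*-zeroˡ x)

  restricted-sum-comb : ∀ B {k} (c : Fin k → ℚ) (p : Fin k → Vecℚ nE) {x} → (∀ i → x i ≡ comb c p i) →
                        restricted-sum B x ≡ ∑ k (λ j → c j * restricted-sum B (p j))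
  restricted-sum-comb B {k} c p {x} x≡ = begin
    restricted-sum B x                        ≡⟨ restricted-sum≡dot B x ⟩
    dot (weight B) x                          ≡⟨ dot-cong (weight B) x≡ ⟩
    dot (weight B) (comb c p)                 ≡⟨ dot-comb (weight B) c p ⟩
    ∑ k (λ j → c j * dot (weight B) (p j))    ≡⟨ ∑-cong k (λ j → cong (c j *_) (restricted-sum≡dot B (p j))) ⟨
    ∑ k (λ j → c j * restricted-sum B (p j))  ∎

  Conservation-comb : ∀ {k} (c : Fin k → ℚ) (p : Fin k → Vecℚ nE) {x} →
                      (∀ j → Conservation G (p j)) → (∀ i → x i ≡ comb c p i) → Conservation G x
  Conservation-comb {k} c p {x} conserved x≡ v inner = begin
    restricted-sum _ x                          ≡⟨ restricted-sum-comb _ c p x≡ ⟩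
    ∑ k (λ j → c j * restricted-sum _ (p j))    ≡⟨ ∑-cong k (λ j → cong (c j *_) (conserved j v inner)) ⟩
    ∑ k (λ j → c j * restricted-sum _ (p j))    ≡⟨ restricted-sum-comb _ c p x≡ ⟨
    restricted-sum _ x                          ∎

  χ-∈ : ∀ {R e} → e ∈ R → χ G R e ≡ 1ℚ
  χ-∈ {R} {e} e∈R = cong (λ b → if b then 1ℚ else 0ℚ) (dec-true (Any.any? (λ e′ → e ≟ᶠ e′) R) e∈R)

  χ-∉ : ∀ {R e} → e ∉ R → χ G R e ≡ 0ℚ
  χ-∉ {R} {e} e∉R = cong (λ b → if b then 1ℚ else 0ℚ) (dec-false (Any.any? (λ e′ → e ≟ᶠ e′) R) e∉R)

  χ-cases : ∀ R e → χ G R e ≡ 1ℚ ⊎ χ G R e ≡ 0ℚ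
  χ-cases R e with Any.any? (λ e′ → e ≟ᶠ e′) R
  ... | yes _ = inj₁ refl
  ... | no  _ = inj₂ refl

  χ-nonneg : ∀ R e → 0ℚ ≤ χ G R e
  χ-nonneg R e = [ (λ eq → subst (0ℚ ≤_) (sym eq) (ℚ.nonNegative⁻¹ 1ℚ)) , ℚ.≤-reflexive ∘ sym ]′ (χ-cases R e)

  χ-lattice : ∀ R → IsLatticePoint (χ G R)
  χ-lattice R e = [ (λ eq → ℤ.+ 1 , eq) , (λ eq → ℤ.+ 0 , eq) ]′ (χ-cases R e)

  total-weight : (Fin nE → Bool) → List (Fin nE) → ℚ
  total-weight B []       = 0ℚ
  total-weight B (e ∷ es) = weight B e + total-weight B es

  χ-∷ : ∀ {e es} → e ∉ es → ∀ i → χ G (e ∷ es) i ≡ δ e i + χ G es i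
  χ-∷ {e} {es} e∉es i with i ≟ᶠ e
  ... | yes refl = sym (trans (cong₂ _+_ (δ-refl e) (χ-∉ e∉es)) (ℚ.+-identityʳ 1ℚ))
  ... | no i≢e   = sym (trans (cong (_+ χ G es i) (δ-≢ (i≢e ∘ sym))) (ℚ.+-identityˡ (χ G es i)))

  -- `χ` records membership while `total-weight` counts multiplicity; uniqueness reconciles them.
  restricted-sum-χ : ∀ B {R} → Unique R → restricted-sum B (χ G R) ≡ total-weight B R
  restricted-sum-χ B {[]} [] = trans (restricted-sum≡dot B (χ G [])) (∑-zero nE (λ i → ℚ.*-zeroʳ (weight B i)))
  restricted-sum-χ B {e ∷ es} (e≢ ∷ unique) = begin
    restricted-sum B (χ G (e ∷ es))      ≡⟨ restricted-sum≡dot B (χ G (e ∷ es)) ⟩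
    dot (weight B) (χ G (e ∷ es))        ≡⟨ ∑-cong nE (λ i → trans
        (cong (weight B i *_) (χ-∷ (λ e∈es → All.lookup e≢ e∈es refl) i))
        (solve 3 (λ w d x → w :* (d :+ x) := d :* w :+ w :* x) refl (weight B i) (δ e i) (χ G es i))) ⟩
    ∑ nE (λ i → δ e i * weight B i + weight B i * χ G es i) ≡⟨ ∑-+ nE (λ i → δ e i * weight B i) (λ i → weight B i * χ G es i) ⟩
    ∑ nE (λ i → δ e i * weight B i) + dot (weight B) (χ G es)
      ≡⟨ cong₂ _+_ (∑-δ e (weight B)) (trans (sym (restricted-sum≡dot B (χ G es))) (restricted-sum-χ B unique)) ⟩
    weight B e + total-weight B es ∎

  entering leaving : Fin nV → Fin nE → Bool
  entering v e = does (tgt e ≟ᶠ v)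
  leaving  v e = does (src e ≟ᶠ v)

  -- Telescoping: each edge enters the vertex that its successor leaves, so only the tail of the
  -- first edge and the head of the last one remain unmatched.
  path-balance : ∀ v {e es} → IsPath G (e ∷ es) →
    total-weight (entering v) (e ∷ es) + weight (leaving v) e ≡
    total-weight (leaving v) (e ∷ es) + weight (entering v) (lastEdge G e es)
  path-balance v [ e ] =
    solve 2 (λ t s → t :+ con 0ℚ :+ s := s :+ con 0ℚ :+ t) refl (weight (entering v) e) (weight (leaving v) e)
  path-balance v {e} {f ∷ es} (e→f ∷ p) = begin
    weight (entering v) e + I + weight (leaving v) e
      ≡⟨ cong (λ u → (if does (u ≟ᶠ v) then 1ℚ else 0ℚ) + I + weight (leaving v) e) e→f ⟩
    weight (leaving v) f + I + weight (leaving v) e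
      ≡⟨ solve 3 (λ t i s → t :+ i :+ s := s :+ (i :+ t)) refl (weight (leaving v) f) I (weight (leaving v) e) ⟩
    weight (leaving v) e + (I + weight (leaving v) f)
      ≡⟨ cong (weight (leaving v) e +_) (path-balance v p) ⟩
    weight (leaving v) e + (O + L)
      ≡⟨ ℚ.+-assoc (weight (leaving v) e) O L ⟨
    weight (leaving v) e + O + L ∎
    where
    I = total-weight (entering v) (f ∷ es)
    O = total-weight (leaving v) (f ∷ es)
    L = weight (entering v) (lastEdge G f es)

  weight-false : ∀ {A : Set} (a? : Dec A) → ¬ A → (if does a? then 1ℚ else 0ℚ) ≡ 0ℚ
  weight-false a? ¬a = cong (λ b → if b then 1ℚ else 0ℚ) (dec-false a? ¬a)

  -- The two boundary terms of `path-balance` vanish, because a route begins at a source and ends at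
  -- a sink and `v` is neither.
  route-conserved : ∀ {R} → IsRoute G R → Conservation G (χ G R)
  route-conserved {e ∷ es} (p , source , sink) v (¬source , ¬sink) = begin
    restricted-sum (entering v) (χ G (e ∷ es)) ≡⟨ restricted-sum-χ (entering v) (path-Unique p) ⟩
    total-weight (entering v) (e ∷ es)
      ≡⟨ ℚ.+-identityʳ _ ⟨
    total-weight (entering v) (e ∷ es) + 0ℚ
      ≡⟨ cong (total-weight (entering v) (e ∷ es) +_) (weight-false (src e ≟ᶠ v) (λ { refl → ¬source source })) ⟨
    total-weight (entering v) (e ∷ es) + weight (leaving v) e ≡⟨ path-balance v p ⟩
    total-weight (leaving v) (e ∷ es) + weight (entering v) (lastEdge G e es)
      ≡⟨ cong (total-weight (leaving v) (e ∷ es) +_) (weight-false (tgt (lastEdge G e es) ≟ᶠ v) (λ { refl → ¬sink sink })) ⟩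
    total-weight (leaving v) (e ∷ es) + 0ℚ
      ≡⟨ ℚ.+-identityʳ _ ⟩
    total-weight (leaving v) (e ∷ es) ≡⟨ restricted-sum-χ (leaving v) (path-Unique p) ⟨
    restricted-sum (leaving v) (χ G (e ∷ es)) ∎

  from-source : Fin nE → Bool
  from-source e = does (source? (src e))

  outflow : Vecℚ nE → ℚ
  outflow = restricted-sum from-source

  no-source-weight : ∀ {es} → All (λ e → ¬ IsSource G (src e)) es → total-weight from-source es ≡ 0ℚ
  no-source-weight []               = refl
  no-source-weight {e ∷ es} (¬s ∷ rest) = trans
    (cong₂ _+_ (weight-false (source? (src e)) ¬s) (no-source-weight rest)) (ℚ.+-identityˡ 0ℚ)

  -- Every edge after the first has a predecessor, so only the first leaves a source.
  route-outflow : ∀ {R} → IsRoute G R → outflow (χ G R) ≡ 1ℚ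
  route-outflow {e ∷ es} (p , source , _) = begin
    outflow (χ G (e ∷ es))                 ≡⟨ restricted-sum-χ from-source (path-Unique p) ⟩
    total-weight from-source (e ∷ es)      ≡⟨ cong₂ _+_
        (cong (λ b → if b then 1ℚ else 0ℚ) (dec-true (source? (src e)) source))
        (no-source-weight (All.map ↝-not-source (↝-reach p))) ⟩
    1ℚ + 0ℚ                                ≡⟨ ℚ.+-identityʳ 1ℚ ⟩
    1ℚ                                     ∎

  route-in-cone : ∀ {R} → IsRoute G R → FlowCone G (χ G R)
  route-in-cone {R} route = χ-nonneg R , route-conserved route

  open Polyhedral (Conservation G) Conservation-comb

  -- The point `h` of `coordinate-facet` is a sum of routes avoiding `e`, one through each other
  -- edge; the point off the face is a route through `e`.
  edge-facet : ∀ e → ¬ ¬ IsFacet (FlowCone G) (λ x → FlowCone G x × x e ≡ 0ℚ)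
  edge-facet e = coordinate-facet {e} {h} {χ G R}
    ((λ i → ∑-nonneg nE (λ j → *-nonneg (ℚ.nonNegative⁻¹ 1ℚ) (proj₁ (flow-cone j) i))) ,
     Conservation-comb (λ _ → 1ℚ) flow (proj₂ ∘ flow-cone) (λ _ → refl))
    (∑-zero nE (λ j → trans (ℚ.*-identityˡ _) (flow-e j)))
    (λ i i≢e → ℚ.≤-trans (ℚ.≤-reflexive (sym (trans (ℚ.*-identityˡ _) (flow-support i i≢e))))
      (≤∑ (λ j → 1ℚ * flow j i) (λ j → *-nonneg (ℚ.nonNegative⁻¹ 1ℚ) (proj₁ (flow-cone j) i)) i))
    (route-in-cone (proj₁ (proj₂ through)))
    (λ eq → ℚ.1≢0 (trans (sym (χ-∈ (proj₁ (proj₂ (proj₂ through))))) eq))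
    where
    module Free = Extension (λ _ → ⊤)
      (λ inner → map₂ (map₂ _) (other-in inner e)) (λ inner → map₂ (map₂ _) (other-out inner e))
    module Avoid = Extension (_≢ e) (λ inner → other-in inner e) (λ inner → other-out inner e)
    through = Free.route-through e tt
    R = proj₁ through
    -- The zero flow fills the place of `e` itself, so that the summands of `h` are indexed by all
    -- edges.
    avoiding : ∀ i → Σ (Vecℚ nE) λ f → FlowCone G f × f e ≡ 0ℚ × (i ≢ e → f i ≡ 1ℚ)
    avoiding i with i ≟ᶠ e
    ... | yes i≡e = (λ _ → 0ℚ) , ((λ _ → ℚ.≤-refl) , Conservation-comb ◂[] ◂[] (λ ()) (λ _ → refl)) , refl , contradiction i≡e
    ... | no i≢e  = let R , route , i∈R , avoids = Avoid.route-through i i≢e in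
      χ G R , route-in-cone route , χ-∉ (λ e∈R → All.lookup avoids e∈R refl) , λ _ → χ-∈ i∈R
    flow = λ i → proj₁ (avoiding i)
    flow-cone = λ i → proj₁ (proj₂ (avoiding i))
    flow-e = λ i → proj₁ (proj₂ (proj₂ (avoiding i)))
    flow-support = λ i → proj₂ (proj₂ (proj₂ (avoiding i)))
    h : Vecℚ nE
    h = comb (λ _ → 1ℚ) flow

  -- Straight pairs and exceptional routes.

  module _ (Fr : Framing G) where
    open Framing Fr

    Crossing : Fin nE → Fin nE → Fin nE → Fin nE → Set
    Crossing e f e′ f′ = (inRank e ℕ.< inRank e′ × outRank f′ ℕ.< outRank f) ⊎
                         (inRank e′ ℕ.< inRank e × outRank f ℕ.< outRank f′)

    -- At an inner vertex with incoming edges e₁ ≺ e₂ and outgoing edges f₁ ≺ f₂, the straight pairs are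
    -- (e₁ , f₁) and (e₂ , f₂).
    Straight : Fin nE → Fin nE → Set
    Straight e f = tgt e ≡ src f ×
      ¬ ∃ λ e′ → ∃ λ f′ → (tgt e′ ≡ src f × src f′ ≡ src f) × Crossing e f e′ f′

    straight? : ∀ e f → Dec (Straight e f)
    straight? e f = (tgt e ≟ᶠ src f) ×-dec ¬? (any? λ e′ → any? λ f′ →
      ((tgt e′ ≟ᶠ src f) ×-dec (src f′ ≟ᶠ src f)) ×-dec
      (((inRank e ℕ.<? inRank e′) ×-dec (outRank f′ ℕ.<? outRank f)) ⊎-dec
       ((inRank e′ ℕ.<? inRank e) ×-dec (outRank f ℕ.<? outRank f′))))

    -- Let `e′` be the other incoming edge. If it lies above `e`, then `(e′ , f)` crosses
    -- `(e , f′)`; if below, then `(e′ , f′)` crosses `(e , f)`.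
    straight-out-≮ : ∀ {e f f′} → Straight e f → Straight e f′ → ¬ outRank f ℕ.< outRank f′
    straight-out-≮ {e} {f} {f′} (e→f , ok) (e→f′ , ok′) f<f′
      with other-in (tgt-src-inner e→f) e
    ... | e′ , e′→f , e′≢e with ℕ.<-cmp (inRank e) (inRank e′)
    ... | tri< e<e′ _ _ = ok′ (e′ , f , (trans e′→f (trans (sym e→f) e→f′) , trans (sym e→f) e→f′) , inj₁ (e<e′ , f<f′))
    ... | tri≈ _ eq _   = e′≢e (sym (inRank-inj e e′ (trans e→f (sym e′→f)) (subst (IsInner G) (sym e→f) (tgt-src-inner e→f)) eq))
    ... | tri> _ _ e′<e = ok (e′ , f′ , (e′→f , trans (sym e→f′) e→f) , inj₂ (e′<e , f<f′))

    straight-out-unique : ∀ {e f f′} → Straight e f → Straight e f′ → f ≡ f′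
    straight-out-unique {e} {f} {f′} s@(e→f , _) s′@(e→f′ , _) with ℕ.<-cmp (outRank f) (outRank f′)
    ... | tri< f<f′ _ _ = contradiction f<f′ (straight-out-≮ s s′)
    ... | tri≈ _ eq _   = outRank-inj f f′ (trans (sym e→f) e→f′) (tgt-src-inner e→f) eq
    ... | tri> _ _ f′<f = contradiction f′<f (straight-out-≮ s′ s)

    straight-in-≮ : ∀ {e e′ f} → Straight e f → Straight e′ f → ¬ inRank e ℕ.< inRank e′
    straight-in-≮ {e} {e′} {f} (e→f , ok) (e′→f , ok′) e<e′
      with other-out (tgt-src-inner e→f) f
    ... | f′ , f′-src , f′≢f with ℕ.<-cmp (outRank f) (outRank f′)
    ... | tri< f<f′ _ _ = ok′ (e , f′ , (e→f , f′-src) , inj₂ (e<e′ , f<f′))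
    ... | tri≈ _ eq _   = f′≢f (sym (outRank-inj f f′ (sym f′-src) (tgt-src-inner e→f) eq))
    ... | tri> _ _ f′<f = ok (e′ , f′ , (e′→f , f′-src) , inj₁ (e<e′ , f′<f))

    straight-in-unique : ∀ {e e′ f} → Straight e f → Straight e′ f → e ≡ e′
    straight-in-unique {e} {e′} {f} s@(e→f , _) s′@(e′→f , _) with ℕ.<-cmp (inRank e) (inRank e′)
    ... | tri< e<e′ _ _ = contradiction e<e′ (straight-in-≮ s s′)
    ... | tri≈ _ eq _   = inRank-inj e e′ (trans e→f (sym e′→f)) (subst (IsInner G) (sym e→f) (tgt-src-inner e→f)) eq
    ... | tri> _ _ e′<e = contradiction e′<e (straight-in-≮ s′ s)

    InLt-∷ʳ : ∀ xs ys {e e′} → inRank e ℕ.< inRank e′ → InLt G Fr (xs ∷ʳ e) (ys ∷ʳ e′)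
    InLt-∷ʳ xs ys {e} {e′} e<e′ =
      subst₂ (InLtRev G Fr) (sym (reverse-++ xs (e ∷ []))) (sym (reverse-++ ys (e′ ∷ []))) (here e<e′)

    -- A route crossing at e → f conflicts with any route through the crossing pair e′ → f′.
    exceptional-Straight : ∀ {R} → IsExceptional G Fr R → ∀ xs {e f es} → R ≡ xs ++ e ∷ f ∷ es →
                           tgt e ≡ src f → Straight e f
    exceptional-Straight {R} (_ , coherent) xs {e} {f} {es} R≡ e→f = e→f , λ { (e′ , f′ , (e′→f , f′-src) , crossing) →
      let fs , to-sink , goods = extend-forward f′
          ys , route , _ = extend-backward e′ (f′ ∷ fs)
            (trans e′→f (sym f′-src) ∷ proj₁ to-sink , proj₂ to-sink) (tt ∷ tt ∷ goods)
      in coherent (ys ++ e′ ∷ f′ ∷ fs) route (src f) (tgt-src-inner e→f)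
           (xs ∷ʳ e , f ∷ es , ys ∷ʳ e′ , f′ ∷ fs ,
            (trans R≡ (sym (∷ʳ-++ xs e (f ∷ es))) , xs , e , refl , e→f) ,
            (sym (∷ʳ-++ ys e′ (f′ ∷ fs)) , ys , e′ , refl , e′→f) ,
            [ (λ { (e<e′ , f′<f) → inj₁ (InLt-∷ʳ xs ys e<e′ , here f′<f) })
            , (λ { (e′<e , f<f′) → inj₂ (InLt-∷ʳ ys xs e′<e , here f<f′) }) ]′ crossing) }
      where
      open Extension (λ _ → ⊤)
        (λ inner → map₂ (map₂ _) (other-in inner e)) (λ inner → map₂ (map₂ _) (other-out inner e))

    -- The prefix `xs` is carried along because coherence concerns the whole route, not the suffix
    -- under induction.
    exceptional-Linked : ∀ {R} → IsExceptional G Fr R → ∀ xs e es → R ≡ xs ++ e ∷ es →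
                         IsPath G (e ∷ es) → Linked Straight (e ∷ es)
    exceptional-Linked exc xs e []       R≡ p           = [-]
    exceptional-Linked exc xs e (f ∷ es) R≡ (e→f ∷ p) =
      exceptional-Straight exc xs R≡ e→f ∷
      exceptional-Linked exc (xs ∷ʳ e) f es (trans R≡ (sym (∷ʳ-++ xs e (f ∷ es)))) p

    -- Built by appending at the end, so that a common last edge can be traced back step by step.
    data StraightFrom (e : Fin nE) : Fin nE → Set where
      start : StraightFrom e e
      step  : ∀ {f g} → StraightFrom e f → Straight f g → StraightFrom e g

    Linked⇒StraightFrom : ∀ {e f fs} → StraightFrom e f → Linked Straight (f ∷ fs) → All (StraightFrom e) (f ∷ fs)
    Linked⇒StraightFrom s [-]      = s ∷ []
    Linked⇒StraightFrom s (t ∷ ts) = s ∷ Linked⇒StraightFrom (step s t) ts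

    -- Straight predecessors are unique, so both paths run backwards in step; neither can stop
    -- earlier, as an edge leaving a source has no predecessor.
    StraightFrom-unique : ∀ {e e′ f} → IsSource G (src e) → IsSource G (src e′) →
                          StraightFrom e f → StraightFrom e′ f → e ≡ e′
    StraightFrom-unique s s′ start      start            = refl
    StraightFrom-unique s s′ start      (step _ (eq , _)) = contradiction s (tgt-not-source eq)
    StraightFrom-unique s s′ (step _ (eq , _)) start      = contradiction s′ (tgt-not-source eq)
    StraightFrom-unique s s′ (step p t) (step p′ t′) with straight-in-unique t t′
    ... | refl = StraightFrom-unique s s′ p p′

    -- Straight successors are unique. The list is only a candidate: that it yields an exceptional
    -- route when `e` leaves a source follows from ampleness in `T-exceptional`.
    straight-continuation : ∀ e → ∃ λ es → ∀ es′ → Linked Straight (e ∷ es′) → IsSink G (tgt (lastEdge G e es′)) → es′ ≡ es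
    straight-continuation e = go e (spo-noetherian ↝-isStrictPartialOrder e)
      where
      go : ∀ e → Acc (flip _↝_) e →
           ∃ λ es → ∀ es′ → Linked Straight (e ∷ es′) → IsSink G (tgt (lastEdge G e es′)) → es′ ≡ es
      go e (acc rs) with any? (straight? e)
      ... | no none = [] , λ { [] _ _ → refl ; (f ∷ _) (s ∷ _) _ → contradiction (f , s) none }
      ... | yes (f , s) = let fs , unique = go f (rs (↝-edge (proj₁ s))) in
        f ∷ fs , λ { []         _        sink → contradiction sink (src-not-sink {f} (sym (proj₁ s)))
                   ; (f′ ∷ fs′) (s′ ∷ l) sink → continue fs unique f′ fs′ (straight-out-unique s′ s) l sink }
        where
        continue : ∀ fs → (∀ es′ → Linked Straight (f ∷ es′) → IsSink G (tgt (lastEdge G f es′)) → es′ ≡ fs) →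
                   ∀ f′ fs′ → f′ ≡ f → Linked Straight (f′ ∷ fs′) → IsSink G (tgt (lastEdge G f′ fs′)) →
                   f′ ∷ fs′ ≡ f ∷ fs
        continue fs unique f′ fs′ refl l sink = cong (f ∷_) (unique fs′ l sink)

    track : Fin nE → List (Fin nE)
    track e = e ∷ proj₁ (straight-continuation e)

    exceptional-track : ∀ {e es} → IsExceptional G Fr (e ∷ es) → e ∷ es ≡ track e
    exceptional-track {e} {es} exc@((p , _ , sink) , _) =
      cong (e ∷_) (proj₂ (straight-continuation e) es (exceptional-Linked exc [] e es refl p) sink)

    path? : ∀ es → Dec (IsPath G es)
    path? []           = yes []
    path? (e ∷ [])     = yes [ e ]
    path? (e ∷ f ∷ es) with tgt e ≟ᶠ src f | path? (f ∷ es)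
    ... | yes eq | yes p = yes (eq ∷ p)
    ... | no ¬eq | _     = no λ { (eq ∷ _) → ¬eq eq }
    ... | _      | no ¬p = no λ { (_ ∷ p) → ¬p p }

    route? : ∀ R → Dec (IsRoute G R)
    route? []       = no λ ()
    route? (e ∷ es) = path? (e ∷ es) ×-dec source? (src e) ×-dec sink? (tgt (lastEdge G e es))

    -- Being a route is decidable, and coherence is a negation.
    exceptional-stable : ∀ {R} → ¬ ¬ IsExceptional G Fr R → IsExceptional G Fr R
    exceptional-stable {R} ¬¬exc = decidable-stable (route? R) (λ ¬r → ¬¬exc (¬r ∘ proj₁)) ,
      λ Q route v inner conflict → ¬¬exc λ exc → proj₂ exc Q route v inner conflict

    first-edge : ∀ {R e} → IsExceptional G Fr R → e ∈ R → IsSource G (src e) → R ≡ track e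
    first-edge {_ ∷ _} exc               (here refl)  _      = exceptional-track exc
    first-edge {_ ∷ _} ((p , _) , _) (there e∈es) source =
      contradiction source (↝-not-source (All.lookup (↝-reach p) e∈es))

    -- The simplex of exceptional routes.

    module _ (ample : IsAmple G Fr) where

      -- Otherwise all exceptional vectors would lie in the facet where coordinate `e` vanishes,
      -- against ampleness.
      exceptional-cover : ∀ e → ¬ ¬ ∃ λ R → IsExceptional G Fr R × e ∈ R
      exceptional-cover e none = edge-facet e λ facet → ample _ facet λ { x (R , exc , x≡) →
        ((λ i → subst (0ℚ ≤_) (sym (x≡ i)) (χ-nonneg R i)) ,
         Conservation-comb {1} (λ _ → 1ℚ) (λ _ → χ G R) (λ _ → route-conserved (proj₁ exc))
           (λ i → trans (x≡ i) (sym (trans (ℚ.+-identityʳ _) (ℚ.*-identityˡ _))))) ,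
        trans (x≡ e) (χ-∉ (λ e∈R → none (R , exc , e∈R))) }

      -- These edges index the exceptional routes: each such route is determined by its first edge,
      -- and each edge leaving a source begins one.
      sources : List (Fin nE)
      sources = filter (λ e → source? (src e)) (allFin nE)

      k : ℕ
      k = length sources

      first : Fin k → Fin nE
      first = List.lookup sources

      first-source : ∀ j → IsSource G (src (first j))
      first-source j = proj₂ (∈-filter⁻ (λ e → source? (src e)) {xs = allFin nE} (∈-lookup j))

      first-injective : ∀ i j → first i ≡ first j → i ≡ j
      first-injective = lookup-injective (Unique.filter⁺ (λ e → source? (src e)) (Unique.allFin⁺ nE))

      first-surjective : ∀ {e} → IsSource G (src e) → ∃ λ j → e ≡ first j
      first-surjective {e} source = Any.index e∈ , lookup-index e∈
        where e∈ = ∈-filter⁺ (λ e → source? (src e)) (∈-allFin e) source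

      T : Fin k → List (Fin nE)
      T j = track (first j)

      -- An exceptional route through `first j` must begin with it and hence equals its track;
      -- stability removes the double negation of the cover.
      T-exceptional : ∀ j → IsExceptional G Fr (T j)
      T-exceptional j = exceptional-stable λ not → exceptional-cover (first j) λ { (R , exc , e∈R) →
        not (subst (IsExceptional G Fr) (first-edge exc e∈R (first-source j)) exc) }

      exceptional⇒T : ∀ {R} → IsExceptional G Fr R → ∃ λ j → R ≡ T j
      exceptional⇒T {e ∷ es} exc@((_ , source , _) , _) =
        let j , e≡ = first-surjective source in j , trans (exceptional-track exc) (cong track e≡)

      -- Tracing back straight from a common edge leads to the same first edge.
      T-disjoint : ∀ {i j e} → e ∈ T i → e ∈ T j → i ≡ j
      T-disjoint {i} {j} e∈i e∈j = first-injective i j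
        (StraightFrom-unique (first-source i) (first-source j) (All.lookup (from i) e∈i) (All.lookup (from j) e∈j))
        where
        from : ∀ i → All (StraightFrom (first i)) (T i)
        from i = let exc = T-exceptional i in
          Linked⇒StraightFrom start (exceptional-Linked exc [] (first i) _ refl (proj₁ (proj₁ exc)))

      vertex : Fin k → Vecℚ nE
      vertex j = χ G (T j)

      vertex-δ : ∀ j l → vertex j (first l) ≡ δ l j
      vertex-δ j l with l ≟ᶠ j
      ... | yes refl = trans (χ-∈ {T j} (here refl)) (sym (δ-refl j))
      ... | no l≢j   = trans (χ-∉ {T j} (λ ∈j → l≢j (T-disjoint (here refl) ∈j))) (sym (δ-≢ l≢j))

      -- At the coordinate `first l` only vertex `l` is nonzero, so the relation there reads
      -- `c l ≡ 0ℚ`.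
      vertex-AffIndep : AffIndep vertex
      vertex-AffIndep c vanish _ l = begin
        c l                                   ≡⟨ ∑-δ l c ⟨
        ∑ k (λ j → δ l j * c j)               ≡⟨ ∑-cong k (λ j → trans (ℚ.*-comm (δ l j) (c j)) (cong (c j *_) (sym (vertex-δ j l)))) ⟩
        ∑ k (λ j → c j * vertex j (first l))  ≡⟨ vanish (first l) ⟩
        0ℚ                                    ∎

      private-vertex : ∀ e → ¬ ¬ ∃ λ j → vertex j e ≢ 0ℚ × (∀ i → i ≢ j → vertex i e ≡ 0ℚ)
      private-vertex e none = exceptional-cover e λ { (R , exc , e∈R) →
        let j , R≡ = exceptional⇒T exc
            e∈T = subst (e ∈_) R≡ e∈R in
        none (j , (λ eq → ℚ.1≢0 (trans (sym (χ-∈ e∈T)) eq)) ,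
              λ i i≢j → χ-∉ (λ e∈Ti → i≢j (T-disjoint e∈Ti e∈T))) }

      vertex∈P : ∀ j → FlowPolytope G (vertex j)
      vertex∈P j = let route = proj₁ (T-exceptional j) in route-in-cone route , route-outflow route

      exceptional-simplex : IsSpecialSimplex (FlowPolytope G) (ConvHull (ExceptionalVectors G Fr))
      exceptional-simplex =
        (k , vertex , vertex-AffIndep , (λ j → χ-lattice (T j) , vertex∈P j) , hull) ,
        Slice.facet-of-simplex outflow (restricted-sum-comb from-source) vertex vertex-AffIndep vertex∈P private-vertex hull
        where
        hull = ConvHull⇔ConvHullOf {A = ExceptionalVectors G Fr} {vertex}
          (λ j → T j , T-exceptional j , λ _ → refl)
          (λ { x (R , exc , x≡) → let j , R≡ = exceptional⇒T exc in
            j , λ i → trans (x≡ i) (cong (λ R → χ G R i) R≡) })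

theorem6p19 : (G : Digraph) → IsAcyclic G → IsFull G →
    (Fr : Framing G) → IsAmple G Fr →
    IsSpecialSimplex (FlowPolytope G) (ConvHull (ExceptionalVectors G Fr))
theorem6p19 = exceptional-simplex
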